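{- Let $n\ge1$ and let $D=d/dx$. The generating polynomial of rooted trees on $n$ labelled vertices enriched with partitions whose blocks are linearly ordered, each block weighted with $x$, is the sum of the numerators in the expansion of $(xD)^{n-1}(1-x)^{ -n}$ in simple fractions; that is, if $$(xD)^{n-1}\frac{1}{(1-x)^n}=\sum_{k=0}^{n-1}\frac{a_{n,k}\,x^k}{(1-x)^{n+k}}$$ with constants $a_{n,k}$ (which exist and are uniquely determined), then this generating polynomial equals $\sum_{k=0}^{n-1}a_{n,k}x^k$.
   Context: The enriched trees in question are (non-plane) rooted trees $T$ on the vertex set $\{1,\dots,n\}$ together with, for each vertex $v$, an ordered set partition (a linearly ordered sequence of nonempty, pairwise disjoint blocks with union equal) of the set $T^{ -1}(v)$ of children of $v$ (the empty sequence if $v$ has no children). The weight of such an object is $x$ raised to the total number of blocks, and the generating polynomial is the sum of the weights of all such objects. -}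

module Defs where

open import Data.Fin.Base using (Fin; toℕ)
open import Data.Fin.Properties using (_≟_)
open import Data.Fin.Subset using (Subset; Nonempty; Empty; _∩_; ⋃)
open import Data.List.Base using (List; []; _∷_; length; map; foldr)
open import Data.List.Membership.Propositional using (_∈_)
open import Data.List.Relation.Unary.All using (All)
open import Data.List.Relation.Unary.AllPairs using (AllPairs)
open import Data.List.Relation.Unary.Unique.Propositional using (Unique)
open import Data.Maybe.Base using (Maybe; just; nothing)
open import Data.Maybe.Properties using (≡-dec)
open import Data.Nat.Base as ℕ using (ℕ; zero; suc)
open import Data.Nat.GeneralisedArithmetic using (iterate)
open import Data.Nat.Induction using (<-rec)
open import Data.Product.Base using (_×_; ∃)
open import Data.Rational.Base as ℚ using (ℚ; 0ℚ; 1ℚ)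
open import Data.Sum.Base using (_⊎_; inj₁; inj₂)
open import Data.Vec.Base as Vec using (Vec; lookup; tabulate)
open import Relation.Binary.Construct.Closure.ReflexiveTransitive using (Star)
open import Relation.Binary.PropositionalEquality using (_≡_; _≢_; refl; sym; trans; cong; cong₂)
open import Relation.Nullary using (¬_; does; yes; no)
import Algebra.Definitions.RawMonoid as RawMonoidDefs
import Data.Nat.Properties as ℕₚ
import Data.Rational.Properties as ℚₚ
import Data.Vec.Functional as Vector

------------------------------------------------------------------------
-- The polynomial ring ℚ[x]

-- Coefficient lists, constant term first; trailing zeros are allowed, so
-- equality of polynomials is _≈ᴾ_ and not _≡_.

Poly : Set
Poly = List ℚ

coeff : Poly → ℕ → ℚ
coeff []      _       = 0ℚ
coeff (a ∷ _) zero    = a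
coeff (_ ∷ p) (suc k) = coeff p k

infix 4 _≈ᴾ_ _≉ᴾ_

_≈ᴾ_ : Poly → Poly → Set
p ≈ᴾ q = ∀ k → coeff p k ≡ coeff q k

_≉ᴾ_ : Poly → Poly → Set
p ≉ᴾ q = ¬ (p ≈ᴾ q)

0ᴾ : Poly
0ᴾ = []

const : ℚ → Poly
const a = a ∷ []

1ᴾ : Poly
1ᴾ = const 1ℚ

X : Poly
X = 0ℚ ∷ 1ℚ ∷ []

infixl 6 _+ᴾ_ _-ᴾ_
infixl 7 _*ᴾ_ _·ᴾ_
infixr 8 _^ᴾ_

_+ᴾ_ : Poly → Poly → Poly
[]      +ᴾ q       = q
(a ∷ p) +ᴾ []      = a ∷ p
(a ∷ p) +ᴾ (b ∷ q) = (a ℚ.+ b) ∷ (p +ᴾ q)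

_·ᴾ_ : ℚ → Poly → Poly
c ·ᴾ p = map (c ℚ.*_) p

_-ᴾ_ : Poly → Poly → Poly
p -ᴾ q = p +ᴾ (ℚ.- 1ℚ) ·ᴾ q

-- (a + x p) q = a q + x (p q)

_*ᴾ_ : Poly → Poly → Poly
[]      *ᴾ q = []
(a ∷ p) *ᴾ q = a ·ᴾ q +ᴾ (0ℚ ∷ p *ᴾ q)

_^ᴾ_ : Poly → ℕ → Poly
p ^ᴾ zero  = 1ᴾ
p ^ᴾ suc m = p *ᴾ p ^ᴾ m

open RawMonoidDefs ℚ.+-0-rawMonoid using () renaming (_×_ to _×ℚ_)

-- weighted m (c₀ ∷ c₁ ∷ …) = m c₀ ∷ (m + 1) c₁ ∷ …

weighted : ℕ → Poly → Poly
weighted m []      = []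
weighted m (a ∷ p) = (m ×ℚ a) ∷ weighted (suc m) p

Dᴾ : Poly → Poly
Dᴾ []      = []
Dᴾ (_ ∷ p) = weighted 1 p

------------------------------------------------------------------------
-- ℚ[x] is an integral domain

coeff-+ : ∀ p q k → coeff (p +ᴾ q) k ≡ coeff p k ℚ.+ coeff q k
coeff-+ []      q       k       = sym (ℚₚ.+-identityˡ (coeff q k))
coeff-+ (a ∷ p) []      k       = sym (ℚₚ.+-identityʳ (coeff (a ∷ p) k))
coeff-+ (a ∷ p) (b ∷ q) zero    = refl
coeff-+ (a ∷ p) (b ∷ q) (suc k) = coeff-+ p q k

coeff-· : ∀ c p k → coeff (c ·ᴾ p) k ≡ c ℚ.* coeff p k
coeff-· c []      k       = sym (ℚₚ.*-zeroʳ c)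
coeff-· c (a ∷ p) zero    = refl
coeff-· c (a ∷ p) (suc k) = coeff-· c p k

coeff-∷* : ∀ a p q k → coeff ((a ∷ p) *ᴾ q) k ≡ a ℚ.* coeff q k ℚ.+ coeff (0ℚ ∷ p *ᴾ q) k
coeff-∷* a p q k = trans (coeff-+ (a ·ᴾ q) (0ℚ ∷ p *ᴾ q) k) (cong (ℚ._+ coeff (0ℚ ∷ p *ᴾ q) k) (coeff-· a q k))

ℚ-cancel : ∀ {a b} → a ≢ 0ℚ → a ℚ.* b ≡ 0ℚ → b ≡ 0ℚ
ℚ-cancel {a} {b} a≢0 ab≡0 =
  trans (sym (ℚₚ.*-identityˡ b))
  (trans (cong (ℚ._* b) (sym (ℚₚ.*-inverseˡ a)))
  (trans (ℚₚ.*-assoc (ℚ.1/ a) a b)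
  (trans (cong (ℚ.1/ a ℚ.*_) ab≡0) (ℚₚ.*-zeroʳ (ℚ.1/ a)))))
  where instance _ = ℚ.≢-nonZero a≢0

*ᴾ-lowZero : ∀ p q k → (∀ {j} → j ℕ.≤ k → coeff q j ≡ 0ℚ) → coeff (p *ᴾ q) k ≡ 0ℚ
*ᴾ-lowZero []      q k q≡0 = refl
*ᴾ-lowZero (a ∷ p) q k q≡0 =
  trans (coeff-∷* a p q k)
  (trans (cong₂ ℚ._+_ (trans (cong (a ℚ.*_) (q≡0 ℕₚ.≤-refl)) (ℚₚ.*-zeroʳ a)) (tail k q≡0)) (ℚₚ.+-identityˡ 0ℚ))
  where
  tail : ∀ k → (∀ {j} → j ℕ.≤ k → coeff q j ≡ 0ℚ) → coeff (0ℚ ∷ p *ᴾ q) k ≡ 0ℚ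
  tail zero    _   = refl
  tail (suc k) q≡0 = *ᴾ-lowZero p q k (λ j≤k → q≡0 (ℕₚ.m≤n⇒m≤1+n j≤k))

*ᴾ-zeroProduct : ∀ p q → p *ᴾ q ≈ᴾ 0ᴾ → (p ≈ᴾ 0ᴾ) ⊎ (q ≈ᴾ 0ᴾ)
*ᴾ-zeroProduct []      q pq≈0 = inj₁ (λ _ → refl)
*ᴾ-zeroProduct (a ∷ p) q pq≈0 with a ℚₚ.≟ 0ℚ
... | yes refl = shift (*ᴾ-zeroProduct p q tail≈0)
  where
  tail≈0 : p *ᴾ q ≈ᴾ 0ᴾ
  tail≈0 k =
    trans (sym (ℚₚ.+-identityˡ _))
    (trans (cong (ℚ._+ coeff (p *ᴾ q) k) (sym (ℚₚ.*-zeroˡ (coeff q (suc k)))))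
    (trans (sym (coeff-∷* 0ℚ p q (suc k))) (pq≈0 (suc k))))
  shift : (p ≈ᴾ 0ᴾ) ⊎ (q ≈ᴾ 0ᴾ) → (0ℚ ∷ p ≈ᴾ 0ᴾ) ⊎ (q ≈ᴾ 0ᴾ)
  shift (inj₁ p≈0) = inj₁ λ { zero → refl ; (suc k) → p≈0 k }
  shift (inj₂ q≈0) = inj₂ q≈0
... | no a≢0 = inj₂ (<-rec (λ k → coeff q k ≡ 0ℚ) step)
  where
  shifted : ∀ k → (∀ {j} → j ℕ.< k → coeff q j ≡ 0ℚ) → coeff (0ℚ ∷ p *ᴾ q) k ≡ 0ℚ
  shifted zero    _  = refl
  shifted (suc k) ih = *ᴾ-lowZero p q k (λ j≤k → ih (ℕ.s≤s j≤k))
  step : ∀ k → (∀ {j} → j ℕ.< k → coeff q j ≡ 0ℚ) → coeff q k ≡ 0ℚ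
  step k ih = ℚ-cancel a≢0
    (trans (sym (ℚₚ.+-identityʳ _))
    (trans (cong (a ℚ.* coeff q k ℚ.+_) (sym (shifted k ih)))
    (trans (sym (coeff-∷* a p q k)) (pq≈0 k))))

*ᴾ-nonZero : ∀ p q → p ≉ᴾ 0ᴾ → q ≉ᴾ 0ᴾ → p *ᴾ q ≉ᴾ 0ᴾ
*ᴾ-nonZero p q p≉0 q≉0 pq≈0 with *ᴾ-zeroProduct p q pq≈0
... | inj₁ p≈0 = p≉0 p≈0
... | inj₂ q≈0 = q≉0 q≈0

1ᴾ-nonZero : 1ᴾ ≉ᴾ 0ᴾ
1ᴾ-nonZero eq with eq 0
... | ()

^ᴾ-nonZero : ∀ p m → p ≉ᴾ 0ᴾ → p ^ᴾ m ≉ᴾ 0ᴾ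
^ᴾ-nonZero p zero    p≉0 = 1ᴾ-nonZero
^ᴾ-nonZero p (suc m) p≉0 = *ᴾ-nonZero p (p ^ᴾ m) p≉0 (^ᴾ-nonZero p m p≉0)

1-X : Poly
1-X = 1ᴾ -ᴾ X

1-X-nonZero : 1-X ≉ᴾ 0ᴾ
1-X-nonZero eq with eq 0
... | ()

------------------------------------------------------------------------
-- The field of rational functions ℚ(x)

record RatFun : Set where
  constructor mkRatFun
  field
    num         : Poly
    den         : Poly
    den-nonZero : den ≉ᴾ 0ᴾ

open RatFun public

infix 4 _≈_
infixl 6 _+_
infixl 7 _*_

_≈_ : RatFun → RatFun → Set
f ≈ g = num f *ᴾ den g ≈ᴾ num g *ᴾ den f

fromPoly : Poly → RatFun
fromPoly p = mkRatFun p 1ᴾ 1ᴾ-nonZero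

_+_ : RatFun → RatFun → RatFun
f + g = mkRatFun (num f *ᴾ den g +ᴾ num g *ᴾ den f) (den f *ᴾ den g)
                 (*ᴾ-nonZero (den f) (den g) (den-nonZero f) (den-nonZero g))

_*_ : RatFun → RatFun → RatFun
f * g = mkRatFun (num f *ᴾ num g) (den f *ᴾ den g)
                 (*ᴾ-nonZero (den f) (den g) (den-nonZero f) (den-nonZero g))

-- Quotient rule.

D : RatFun → RatFun
D f = mkRatFun (Dᴾ (num f) *ᴾ den f -ᴾ num f *ᴾ Dᴾ (den f)) (den f *ᴾ den f)
               (*ᴾ-nonZero (den f) (den f) (den-nonZero f) (den-nonZero f))

xD : RatFun → RatFun
xD f = fromPoly X * D f

infix 7 _/[1-x]^_

_/[1-x]^_ : Poly → ℕ → RatFun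
p /[1-x]^ m = mkRatFun p (1-X ^ᴾ m) (^ᴾ-nonZero 1-X m 1-X-nonZero)

sumᴾ : ∀ {n} → (Fin n → Poly) → Poly
sumᴾ = Vector.foldr _+ᴾ_ 0ᴾ

sum : ∀ {n} → (Fin n → RatFun) → RatFun
sum = Vector.foldr _+_ (fromPoly 0ᴾ)

monomial : ℚ → ℕ → Poly
monomial c k = const c *ᴾ X ^ᴾ k

IsSimpleFractionExpansion : (n : ℕ) → (Fin n → ℚ) → Set
IsSimpleFractionExpansion n a =
  iterate xD (1ᴾ /[1-x]^ n) (n ℕ.∸ 1)
    ≈ sum (λ k → monomial (a k) (toℕ k) /[1-x]^ (n ℕ.+ toℕ k))

numeratorSum : ∀ {n} → (Fin n → ℚ) → Poly
numeratorSum a = sumᴾ (λ k → monomial (a k) (toℕ k))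

------------------------------------------------------------------------
-- Rooted trees enriched with ordered set partitions

-- A rooted tree is given by its parent map, undefined exactly at the root.

ParentMap : ℕ → Set
ParentMap n = Vec (Maybe (Fin n)) n

HasParent : ∀ {n} → ParentMap n → Fin n → Fin n → Set
HasParent T u v = lookup T u ≡ just v

IsRootedTree : ∀ {n} → ParentMap n → Set
IsRootedTree T = ∃ λ r → lookup T r ≡ nothing × (∀ v → Star (HasParent T) v r)

children : ∀ {n} → ParentMap n → Fin n → Subset n
children T v = tabulate (λ u → does (≡-dec _≟_ (lookup T u) (just v)))

IsOrderedPartition : ∀ {n} → List (Subset n) → Subset n → Set
IsOrderedPartition bs s = All Nonempty bs × AllPairs (λ b c → Empty (b ∩ c)) bs × ⋃ bs ≡ s

-- Raw data: first-order, so that _≡_ is equality of labelled structures.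
-- Validity is the separate predicate IsEnrichedTree.

record TreeData (n : ℕ) : Set where
  constructor treeData
  field
    parent : ParentMap n
    blocks : Vec (List (Subset n)) n

open TreeData public

IsEnrichedTree : ∀ {n} → TreeData n → Set
IsEnrichedTree t =
  IsRootedTree (parent t) × (∀ v → IsOrderedPartition (lookup (blocks t) v) (children (parent t) v))

blockCount : ∀ {n} → TreeData n → ℕ
blockCount t = Vec.sum (Vec.map length (blocks t))

weight : ∀ {n} → TreeData n → Poly
weight t = X ^ᴾ blockCount t

-- A duplicate-free list of all enriched trees on n labelled vertices, over
-- which the generating polynomial is summed.

record Enumeration (n : ℕ) : Set where
  field
    list     : List (TreeData n)
    unique   : Unique list
    sound    : ∀ {t} → t ∈ list → IsEnrichedTree t
    complete : ∀ {t} → IsEnrichedTree t → t ∈ list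

open Enumeration public

generatingPolynomial : ∀ {n} → Enumeration n → Poly
generatingPolynomial E = foldr (λ t p → weight t +ᴾ p) 0ᴾ (list E)

{-# OPTIONS --safe #-}
module Submission where

open import Defs hiding (_+_; _*_; _≈_; sum)
import Defs
open import Algebra.Bundles using (CommutativeRing)
open import Algebra.Solver.Ring.AlmostCommutativeRing using (fromCommutativeRing; _-Raw-AlmostCommutative⟶_; AlmostCommutativeRing)
open import Data.Bool.Base using (Bool; true; false; if_then_else_)
open import Data.Empty using (⊥-elim)
open import Data.Fin.Base as Fin using (Fin; toℕ)
open import Data.Fin.Properties using () renaming (_≟_ to _≟ᶠ_)
open import Data.Fin.Subset using (Subset; inside; outside; Nonempty; Empty; _∩_; ⋃) renaming (_∈_ to _∈ˢ_; _∉_ to _∉ˢ_)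
open import Data.Fin.Subset.Properties using (x∈p∩q⁺; x∈p∩q⁻; x∈p∪q⁺; x∈p∪q⁻; ∉⊥; ⊆-antisym) renaming (_∈?_ to _∈ˢ?_)
open import Data.List.Base as List using (List; []; _∷_; _++_; length; map; concat)
open import Data.List.Membership.Propositional using (_∈_)
open import Data.List.Membership.Propositional.Properties
  using (∈-map⁺; ∈-map⁻; ∈-++⁺ˡ; ∈-++⁺ʳ; ∈-++⁻; ∈-concat⁺′; ∈-concat⁻′; ∈-tabulate⁺; ∈-tabulate⁻)
open import Data.List.Membership.Propositional.Properties.WithK using (unique∧set⇒bag)
open import Data.List.Properties using (map-++; map-∘; map-cong; ∷-injectiveˡ)
open import Data.List.Relation.Binary.BagAndSetEquality using (∼bag⇒↭)
open import Data.List.Relation.Unary.All as All using (All; []; _∷_)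
open import Data.List.Relation.Unary.AllPairs as AllPairs using (AllPairs; []; _∷_)
open import Data.List.Relation.Unary.Any using (Any; here; there)
open import Data.List.Relation.Unary.Unique.Propositional using (Unique)
open import Data.Maybe.Base as Maybe using (Maybe; just; nothing)
open import Data.Maybe.Properties using (≡-dec; just-injective)
open import Data.Nat.Base as ℕ using (ℕ; zero; suc; _+_; _*_; _<_; _≤_; s≤s; z≤n)
open import Data.Nat.GeneralisedArithmetic using (iterate)
open import Data.Nat.ListAction using (sum)
open import Data.Nat.ListAction.Properties using (sum-++; sum-↭)
open import Data.Nat.Properties using (+-identityʳ; +-suc; +-assoc; +-comm; +-cancelˡ-≡; *-assoc; *-comm; *-zeroʳ; *-distribˡ-+)
open import Data.Nat.Solver using (module +-*-Solver)
open import Data.Product using (_×_; _,_; ∃; ∃!; proj₁; proj₂)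
open import Data.Rational.Base as ℚ using (ℚ; 0ℚ; 1ℚ)
open import Data.Sum.Base using (_⊎_; inj₁; inj₂)
open import Data.Vec.Base as Vec using (Vec; []; _∷_; lookup; tabulate; replicate; _[_]≔_; _[_]%=_; here; there)
open import Data.Vec.Properties
  using (lookup∘tabulate; tabulate∘lookup; tabulate-cong; lookup∘updateAt; lookup∘updateAt′; lookup-replicate; lookup-zipWith; []=⇒lookup; lookup⇒[]=)
  renaming (∷-injective to ∷ᵛ-injective; ∷-injectiveʳ to ∷ᵛ-injectiveʳ)
open import Function.Base using (_∘_)
open import Function.Bundles using (mk⇔)
open import Relation.Binary.Construct.Closure.ReflexiveTransitive using (Star; ε; _◅_)
open import Relation.Binary.PropositionalEquality using (_≡_; _≢_; _≗_; refl; sym; trans; cong; cong₂; subst; subst₂; module ≡-Reasoning)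
open import Relation.Nullary using (Dec; yes; no; ¬_; does)
open import Relation.Nullary.Decidable using (dec-true; dec⇒maybe)
import Algebra.Properties.CommutativeMonoid.Mult as MultProperties
import Algebra.Properties.CommutativeSemigroup as CommutativeSemigroupProperties
import Algebra.Properties.Group as GroupProperties
import Algebra.Solver.Ring as RingSolver
import Data.Fin.Properties as Finₚ
import Data.List.Relation.Binary.Permutation.Propositional.Properties as ↭ₚ
import Data.List.Relation.Unary.All.Properties as Allₚ
import Data.List.Relation.Unary.AllPairs.Properties as AllPairsₚ
import Data.List.Relation.Unary.Unique.Propositional.Properties as Uniqueₚ
import Data.Nat.Properties as ℕₚ
import Data.Rational.Properties as ℚₚ
import Relation.Binary.Reasoning.Setoid as SetoidReasoning
open import Algebra.Definitions.RawMonoid ℚ.+-0-rawMonoid using () renaming (_×_ to _×ℚ_)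

-- Both sides have coefficients S(n-1,k) n(n+1)⋯(n+k-1), where S denotes Stirling numbers of the
-- second kind.
-- Fractions: xD sends xᵏ/(1-x)ᵐ to k xᵏ/(1-x)ᵐ + m xᵏ⁺¹/(1-x)ᵐ⁺¹, which turns the iteration of xD
-- into the Stirling recurrence; uniqueness is triangularity of the xᵏ(1-x)ʲ⁻ᵏ.
-- Trees: consider forests with r pending roots, m unplaced vertices and k blocks.  Pick any pending
-- root v: either v has no block and can be discarded, or its first block is a nonempty set B of
-- unplaced vertices; detaching B makes its elements pending.  Hence the number f of forests satisfies
--   f k (r + 1) m = f k r m + Σ_{∅ ≠ B ⊆ [m]} f (k - 1) (r + 1 + |B|) (m - |B|),
-- which is solved by f k r m = r S(m,k) (m+r+1)⋯(m+r+k-1).  A tree is a forest with r = 1 and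
-- m = n - 1, the root being any of the n vertices.

-- The closed form for f has a direct reading. Put N = m + r. Handing k given blocks out to N
-- vertices, in linear order at each vertex and with cycles allowed, can be done in N(N+1)...(N+k-1)
-- ways; the share r/N of acyclic outcomes replaces the first factor N by r. Writing the result
-- without the division costs a separate clause for k = 0. Only the first block of v is detached,
-- not all of them: the sum then ranges over single subsets B, and since v stays pending, r + m is
-- the same in all its summands. This is what makes the rising factorial a common factor. The
-- generating polynomial is summed over an arbitrary duplicate-free list of structures, so the
-- recurrence has to be carried out on lists and not merely on numbers. Each list is built together
-- with proofs of soundness, completeness, absence of repetitions and its counts. The intermediate
-- forests have the same type `TreeData n` as the final trees; a vector of statuses tells which
-- vertices still take part.

-- The ring of polynomials

-- _≈ᴾ_ as a record, so that both polynomials can be inferred from a proof.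
infix 4 _≋_
record _≋_ (p q : Poly) : Set where
  constructor mk≋
  field at : p ≈ᴾ q

open _≋_

≋-refl : ∀ {p} → p ≋ p
≋-refl = mk≋ λ _ → refl

≋-sym : ∀ {p q} → p ≋ q → q ≋ p
≋-sym e = mk≋ λ k → sym (at e k)

≋-trans : ∀ {p q r} → p ≋ q → q ≋ r → p ≋ r
≋-trans e f = mk≋ λ k → trans (at e k) (at f k)

∷-cong : ∀ {a b p q} → a ≡ b → p ≋ q → a ∷ p ≋ b ∷ q
∷-cong a≡b e = mk≋ λ { zero → a≡b ; (suc k) → at e k }

0∷0≋0 : 0ℚ ∷ [] ≋ []
0∷0≋0 = mk≋ λ { zero → refl ; (suc k) → refl }

+ᴾ-cong : ∀ {p p′ q q′} → p ≋ p′ → q ≋ q′ → p +ᴾ q ≋ p′ +ᴾ q′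
+ᴾ-cong {p} {p′} {q} {q′} e f = mk≋ λ k →
  trans (coeff-+ p q k) (trans (cong₂ ℚ._+_ (at e k) (at f k)) (sym (coeff-+ p′ q′ k)))

+ᴾ-congʳ : ∀ p {q q′} → q ≋ q′ → p +ᴾ q ≋ p +ᴾ q′
+ᴾ-congʳ p = +ᴾ-cong (≋-refl {p})

+ᴾ-congˡ : ∀ q {p p′} → p ≋ p′ → p +ᴾ q ≋ p′ +ᴾ q
+ᴾ-congˡ q e = +ᴾ-cong e (≋-refl {q})

+ᴾ-assoc : ∀ p q r → (p +ᴾ q) +ᴾ r ≋ p +ᴾ (q +ᴾ r)
+ᴾ-assoc []      q       r       = ≋-refl
+ᴾ-assoc (a ∷ p) []      r       = ≋-refl
+ᴾ-assoc (a ∷ p) (b ∷ q) []      = ≋-refl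
+ᴾ-assoc (a ∷ p) (b ∷ q) (c ∷ r) = ∷-cong (ℚₚ.+-assoc a b c) (+ᴾ-assoc p q r)

+ᴾ-comm : ∀ p q → p +ᴾ q ≋ q +ᴾ p
+ᴾ-comm []      []      = ≋-refl
+ᴾ-comm []      (b ∷ q) = ≋-refl
+ᴾ-comm (a ∷ p) []      = ≋-refl
+ᴾ-comm (a ∷ p) (b ∷ q) = ∷-cong (ℚₚ.+-comm a b) (+ᴾ-comm p q)

+ᴾ-identityʳ : ∀ p → p +ᴾ [] ≋ p
+ᴾ-identityʳ p = +ᴾ-comm p []

·ᴾ-congʳ : ∀ a {p q} → p ≋ q → a ·ᴾ p ≋ a ·ᴾ q
·ᴾ-congʳ a {p} {q} e = mk≋ λ k →
  trans (coeff-· a p k) (trans (cong (a ℚ.*_) (at e k)) (sym (coeff-· a q k)))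

·ᴾ-zeroˡ : ∀ p → 0ℚ ·ᴾ p ≋ []
·ᴾ-zeroˡ p = mk≋ λ k → trans (coeff-· 0ℚ p k) (ℚₚ.*-zeroˡ (coeff p k))

·ᴾ-identityˡ : ∀ p → 1ℚ ·ᴾ p ≋ p
·ᴾ-identityˡ p = mk≋ λ k → trans (coeff-· 1ℚ p k) (ℚₚ.*-identityˡ (coeff p k))

·ᴾ-assoc : ∀ a b p → a ·ᴾ (b ·ᴾ p) ≋ (a ℚ.* b) ·ᴾ p
·ᴾ-assoc a b []      = ≋-refl
·ᴾ-assoc a b (c ∷ p) = ∷-cong (sym (ℚₚ.*-assoc a b c)) (·ᴾ-assoc a b p)

·ᴾ-distribˡ-+ᴾ : ∀ a p q → a ·ᴾ (p +ᴾ q) ≋ a ·ᴾ p +ᴾ a ·ᴾ q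
·ᴾ-distribˡ-+ᴾ a []      q       = ≋-refl
·ᴾ-distribˡ-+ᴾ a (b ∷ p) []      = ≋-refl
·ᴾ-distribˡ-+ᴾ a (b ∷ p) (c ∷ q) = ∷-cong (ℚₚ.*-distribˡ-+ a b c) (·ᴾ-distribˡ-+ᴾ a p q)

·ᴾ-distribʳ-+ : ∀ p a b → (a ℚ.+ b) ·ᴾ p ≋ a ·ᴾ p +ᴾ b ·ᴾ p
·ᴾ-distribʳ-+ []      a b = ≋-refl
·ᴾ-distribʳ-+ (c ∷ p) a b = ∷-cong (ℚₚ.*-distribʳ-+ c a b) (·ᴾ-distribʳ-+ p a b)

interchange : ∀ p q r s → (p +ᴾ q) +ᴾ (r +ᴾ s) ≋ (p +ᴾ r) +ᴾ (q +ᴾ s)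
interchange p q r s =
  ≋-trans (+ᴾ-assoc p q (r +ᴾ s))
  (≋-trans (+ᴾ-congʳ p
    (≋-trans (≋-sym (+ᴾ-assoc q r s)) (≋-trans (+ᴾ-congˡ s (+ᴾ-comm q r)) (+ᴾ-assoc r q s))))
  (≋-sym (+ᴾ-assoc p r (q +ᴾ s))))

0∷-+ᴾ : ∀ p q → 0ℚ ∷ (p +ᴾ q) ≋ (0ℚ ∷ p) +ᴾ (0ℚ ∷ q)
0∷-+ᴾ p q = ∷-cong refl ≋-refl

*ᴾ-congʳ : ∀ p {q q′} → q ≋ q′ → p *ᴾ q ≋ p *ᴾ q′
*ᴾ-congʳ []      e = ≋-refl
*ᴾ-congʳ (a ∷ p) e = +ᴾ-cong (·ᴾ-congʳ a e) (∷-cong refl (*ᴾ-congʳ p e))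

*ᴾ-zeroʳ : ∀ p → p *ᴾ [] ≋ []
*ᴾ-zeroʳ []      = ≋-refl
*ᴾ-zeroʳ (a ∷ p) = ≋-trans (∷-cong refl (*ᴾ-zeroʳ p)) 0∷0≋0

-- The defining recursion of `_*ᴾ_`, mirrored to the second factor; commutativity follows from the
-- two by induction.
*ᴾ-∷ʳ : ∀ p b q → p *ᴾ (b ∷ q) ≋ b ·ᴾ p +ᴾ (0ℚ ∷ p *ᴾ q)
*ᴾ-∷ʳ []      b q = ≋-sym 0∷0≋0
*ᴾ-∷ʳ (a ∷ p) b q = ∷-cong (cong (ℚ._+ 0ℚ) (ℚₚ.*-comm a b))
  (≋-trans (+ᴾ-congʳ (a ·ᴾ q) (*ᴾ-∷ʳ p b q))
  (≋-trans (≋-sym (+ᴾ-assoc (a ·ᴾ q) (b ·ᴾ p) _))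
  (≋-trans (+ᴾ-cong (+ᴾ-comm (a ·ᴾ q) (b ·ᴾ p)) ≋-refl)
  (+ᴾ-assoc (b ·ᴾ p) (a ·ᴾ q) _))))

*ᴾ-comm : ∀ p q → p *ᴾ q ≋ q *ᴾ p
*ᴾ-comm []      q = ≋-sym (*ᴾ-zeroʳ q)
*ᴾ-comm (a ∷ p) q = ≋-trans (+ᴾ-cong ≋-refl (∷-cong refl (*ᴾ-comm p q))) (≋-sym (*ᴾ-∷ʳ q a p))

-- Equal polynomials may have lists of different lengths, so the recursions on two equal left
-- factors do not line up. Commutativity moves the change to the right factor, where `*ᴾ-congʳ`
-- applies.
*ᴾ-cong : ∀ {p p′ q q′} → p ≋ p′ → q ≋ q′ → p *ᴾ q ≋ p′ *ᴾ q′
*ᴾ-cong {p} {p′} {q} {q′} e f =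
  ≋-trans (*ᴾ-congʳ p f) (≋-trans (*ᴾ-comm p q′) (≋-trans (*ᴾ-congʳ q′ e) (*ᴾ-comm q′ p′)))

*ᴾ-congˡ : ∀ q {p p′} → p ≋ p′ → p *ᴾ q ≋ p′ *ᴾ q
*ᴾ-congˡ q e = *ᴾ-cong e (≋-refl {q})

*ᴾ-distribʳ-+ᴾ : ∀ r p q → (p +ᴾ q) *ᴾ r ≋ p *ᴾ r +ᴾ q *ᴾ r
*ᴾ-distribʳ-+ᴾ r []      q       = ≋-refl
*ᴾ-distribʳ-+ᴾ r (a ∷ p) []      = ≋-sym (+ᴾ-identityʳ _)
*ᴾ-distribʳ-+ᴾ r (a ∷ p) (b ∷ q) =
  ≋-trans (+ᴾ-cong (·ᴾ-distribʳ-+ r a b) (≋-trans (∷-cong refl (*ᴾ-distribʳ-+ᴾ r p q)) (0∷-+ᴾ (p *ᴾ r) (q *ᴾ r))))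
  (interchange (a ·ᴾ r) (b ·ᴾ r) (0ℚ ∷ p *ᴾ r) (0ℚ ∷ q *ᴾ r))

·ᴾ-*ᴾ : ∀ a p q → (a ·ᴾ p) *ᴾ q ≋ a ·ᴾ (p *ᴾ q)
·ᴾ-*ᴾ a []      q = ≋-refl
·ᴾ-*ᴾ a (b ∷ p) q =
  ≋-trans (+ᴾ-cong (≋-sym (·ᴾ-assoc a b q)) (∷-cong (sym (ℚₚ.*-zeroʳ a)) (·ᴾ-*ᴾ a p q)))
  (≋-sym (·ᴾ-distribˡ-+ᴾ a (b ·ᴾ q) (0ℚ ∷ p *ᴾ q)))

0∷-*ᴾ : ∀ p q → (0ℚ ∷ p) *ᴾ q ≋ 0ℚ ∷ p *ᴾ q
0∷-*ᴾ p q = +ᴾ-cong (·ᴾ-zeroˡ q) ≋-refl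

*ᴾ-assoc : ∀ p q r → (p *ᴾ q) *ᴾ r ≋ p *ᴾ (q *ᴾ r)
*ᴾ-assoc []      q r = ≋-refl
*ᴾ-assoc (a ∷ p) q r =
  ≋-trans (*ᴾ-distribʳ-+ᴾ r (a ·ᴾ q) (0ℚ ∷ p *ᴾ q))
  (+ᴾ-cong (·ᴾ-*ᴾ a q r) (≋-trans (0∷-*ᴾ (p *ᴾ q) r) (∷-cong refl (*ᴾ-assoc p q r))))

*ᴾ-identityˡ : ∀ p → 1ᴾ *ᴾ p ≋ p
*ᴾ-identityˡ p = ≋-trans (+ᴾ-cong (·ᴾ-identityˡ p) 0∷0≋0) (+ᴾ-identityʳ p)

-- Chosen so that `p -ᴾ q` unfolds to `p +ᴾ (-ᴾ q)`; the ring solver can then treat the `_-ᴾ_` of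
-- the quotient rule as subtraction.
-ᴾ_ : Poly → Poly
-ᴾ p = (ℚ.- 1ℚ) ·ᴾ p

-ᴾ-inverseʳ : ∀ p → p +ᴾ (-ᴾ p) ≋ []
-ᴾ-inverseʳ p =
  ≋-trans (+ᴾ-cong (≋-sym (·ᴾ-identityˡ p)) ≋-refl)
  (≋-trans (≋-sym (·ᴾ-distribʳ-+ p 1ℚ (ℚ.- 1ℚ))) (·ᴾ-zeroˡ p))

Poly-commutativeRing : CommutativeRing _ _
Poly-commutativeRing = record
  { Carrier = Poly ; _≈_ = _≋_ ; _+_ = _+ᴾ_ ; _*_ = _*ᴾ_ ; -_ = -ᴾ_ ; 0# = 0ᴾ ; 1# = 1ᴾ
  ; isCommutativeRing = record
    { isRing = record
      { +-isAbelianGroup = record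
        { isGroup = record
          { isMonoid = record
            { isSemigroup = record
              { isMagma = record
                { isEquivalence = record { refl = ≋-refl ; sym = ≋-sym ; trans = ≋-trans }
                ; ∙-cong = +ᴾ-cong }
              ; assoc = +ᴾ-assoc }
            ; identity = (λ _ → ≋-refl) , +ᴾ-identityʳ }
          ; inverse = (λ p → ≋-trans (+ᴾ-comm (-ᴾ p) p) (-ᴾ-inverseʳ p)) , -ᴾ-inverseʳ
          ; ⁻¹-cong = ·ᴾ-congʳ (ℚ.- 1ℚ) }
        ; comm = +ᴾ-comm }
      ; *-cong = *ᴾ-cong
      ; *-assoc = *ᴾ-assoc
      ; *-identity = *ᴾ-identityˡ , λ p → ≋-trans (*ᴾ-comm p 1ᴾ) (*ᴾ-identityˡ p)
      ; distrib = (λ p q r → ≋-trans (*ᴾ-comm p (q +ᴾ r))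
                    (≋-trans (*ᴾ-distribʳ-+ᴾ p q r) (+ᴾ-cong (*ᴾ-comm q p) (*ᴾ-comm r p))))
                , *ᴾ-distribʳ-+ᴾ }
    ; *-comm = *ᴾ-comm } }

module ≋-Reasoning = SetoidReasoning (CommutativeRing.setoid Poly-commutativeRing)

Poly-almostCommutativeRing : AlmostCommutativeRing _ _
Poly-almostCommutativeRing = fromCommutativeRing Poly-commutativeRing

-- With ℚ as coefficient ring the solver can decide equality of constants, so that terms with
-- factors such as `const (ℚ.- 1ℚ)` cancel.
const-morphism : ℚ.+-*-rawRing -Raw-AlmostCommutative⟶ Poly-almostCommutativeRing
const-morphism = record
  { ⟦_⟧    = const
  ; +-homo = λ _ _ → ≋-refl
  ; *-homo = λ a b → ∷-cong (sym (ℚₚ.+-identityʳ (a ℚ.* b))) ≋-refl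
  ; -‿homo = λ a → ∷-cong (trans (cong ℚ.-_ (sym (ℚₚ.*-identityˡ a))) (ℚₚ.neg-distribˡ-* 1ℚ a)) ≋-refl
  ; 0-homo = 0∷0≋0
  ; 1-homo = ≋-refl
  }

const-≟ : ∀ a b → Maybe (const a ≋ const b)
const-≟ a b = Maybe.map (λ { refl → ≋-refl }) (dec⇒maybe (a ℚₚ.≟ b))

module PolySolver = RingSolver ℚ.+-*-rawRing Poly-almostCommutativeRing const-morphism const-≟

-- The formal derivative and the product rule

×ℚ-zeroʳ : ∀ m → m ×ℚ 0ℚ ≡ 0ℚ
×ℚ-zeroʳ zero    = refl
×ℚ-zeroʳ (suc m) = trans (ℚₚ.+-identityˡ _) (×ℚ-zeroʳ m)

×ℚ-* : ∀ m a b → m ×ℚ (a ℚ.* b) ≡ a ℚ.* (m ×ℚ b)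
×ℚ-* zero    a b = sym (ℚₚ.*-zeroʳ a)
×ℚ-* (suc m) a b = trans (cong (a ℚ.* b ℚ.+_) (×ℚ-* m a b)) (sym (ℚₚ.*-distribˡ-+ a b (m ×ℚ b)))

weighted-+ᴾ : ∀ m p q → weighted m (p +ᴾ q) ≋ weighted m p +ᴾ weighted m q
weighted-+ᴾ m []      q       = ≋-refl
weighted-+ᴾ m (a ∷ p) []      = ≋-refl
weighted-+ᴾ m (a ∷ p) (b ∷ q) = ∷-cong (×-distrib-+ a b m) (weighted-+ᴾ (suc m) p q)
  where open MultProperties ℚₚ.+-0-commutativeMonoid using (×-distrib-+)

weighted-·ᴾ : ∀ m a p → weighted m (a ·ᴾ p) ≋ a ·ᴾ weighted m p
weighted-·ᴾ m a []      = ≋-refl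
weighted-·ᴾ m a (b ∷ p) = ∷-cong (×ℚ-* m a b) (weighted-·ᴾ (suc m) a p)

weighted-suc : ∀ m p → weighted (suc m) p ≋ p +ᴾ weighted m p
weighted-suc m []      = ≋-refl
weighted-suc m (a ∷ p) = ∷-cong refl (weighted-suc (suc m) p)

weighted-cong : ∀ m {p q} → p ≋ q → weighted m p ≋ weighted m q
weighted-cong m {p} {q} e = mk≋ λ k →
  trans (coeff-weighted m p k) (trans (cong ((k ℕ.+ m) ×ℚ_) (at e k)) (sym (coeff-weighted m q k)))
  where
  coeff-weighted : ∀ m p k → coeff (weighted m p) k ≡ (k ℕ.+ m) ×ℚ coeff p k
  coeff-weighted m []      k       = sym (×ℚ-zeroʳ (k ℕ.+ m))
  coeff-weighted m (a ∷ p) zero    = refl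
  coeff-weighted m (a ∷ p) (suc k) = trans (coeff-weighted (suc m) p k) (cong (_×ℚ coeff p k) (ℕₚ.+-suc k m))

-- `weighted 0` is the operator x d/dx on polynomials. Unlike `Dᴾ` it treats all list entries alike,
-- so congruence is proved for it and then read back from index 1 on.
0∷Dᴾ : ∀ p → 0ℚ ∷ Dᴾ p ≋ weighted 0 p
0∷Dᴾ []      = 0∷0≋0
0∷Dᴾ (a ∷ p) = ≋-refl

Dᴾ-cong : ∀ {p q} → p ≋ q → Dᴾ p ≋ Dᴾ q
Dᴾ-cong {p} {q} e = mk≋ λ k → at (≋-trans (0∷Dᴾ p) (≋-trans (weighted-cong 0 e) (≋-sym (0∷Dᴾ q)))) (suc k)

Dᴾ-+ᴾ : ∀ p q → Dᴾ (p +ᴾ q) ≋ Dᴾ p +ᴾ Dᴾ q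
Dᴾ-+ᴾ []      q       = ≋-refl
Dᴾ-+ᴾ (a ∷ p) []      = ≋-sym (+ᴾ-identityʳ _)
Dᴾ-+ᴾ (a ∷ p) (b ∷ q) = weighted-+ᴾ 1 p q

Dᴾ-·ᴾ : ∀ a p → Dᴾ (a ·ᴾ p) ≋ a ·ᴾ Dᴾ p
Dᴾ-·ᴾ a []      = ≋-refl
Dᴾ-·ᴾ a (b ∷ p) = weighted-·ᴾ 1 a p

-- The rule (a + x p)' = p + x p', in the shape of the recursion of `_*ᴾ_`; it drives the induction
-- in `Dᴾ-*ᴾ`.
Dᴾ-∷ : ∀ a p → Dᴾ (a ∷ p) ≋ p +ᴾ (0ℚ ∷ Dᴾ p)
Dᴾ-∷ a p = ≋-trans (weighted-suc 0 p) (+ᴾ-cong ≋-refl (≋-sym (0∷Dᴾ p)))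

Dᴾ-*ᴾ : ∀ p q → Dᴾ (p *ᴾ q) ≋ Dᴾ p *ᴾ q +ᴾ p *ᴾ Dᴾ q
Dᴾ-*ᴾ []      q = ≋-refl
Dᴾ-*ᴾ (a ∷ p) q = begin
  Dᴾ (a ·ᴾ q +ᴾ (0ℚ ∷ p *ᴾ q))
    ≈⟨ Dᴾ-+ᴾ (a ·ᴾ q) (0ℚ ∷ p *ᴾ q) ⟩
  Dᴾ (a ·ᴾ q) +ᴾ Dᴾ (0ℚ ∷ p *ᴾ q)
    ≈⟨ +ᴾ-cong (Dᴾ-·ᴾ a q) (Dᴾ-∷ 0ℚ (p *ᴾ q)) ⟩
  a ·ᴾ Dᴾ q +ᴾ (p *ᴾ q +ᴾ (0ℚ ∷ Dᴾ (p *ᴾ q)))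
    ≈⟨ +ᴾ-congʳ (a ·ᴾ Dᴾ q) (+ᴾ-congʳ (p *ᴾ q) (≋-trans (∷-cong refl (Dᴾ-*ᴾ p q)) (0∷-+ᴾ (Dᴾ p *ᴾ q) (p *ᴾ Dᴾ q)))) ⟩
  a ·ᴾ Dᴾ q +ᴾ (p *ᴾ q +ᴾ ((0ℚ ∷ Dᴾ p *ᴾ q) +ᴾ (0ℚ ∷ p *ᴾ Dᴾ q)))
    ≈⟨ solve 4 (λ w x y z → w :+ (x :+ (y :+ z)) := (x :+ y) :+ (w :+ z)) ≋-refl
         (a ·ᴾ Dᴾ q) (p *ᴾ q) (0ℚ ∷ Dᴾ p *ᴾ q) (0ℚ ∷ p *ᴾ Dᴾ q) ⟩
  (p *ᴾ q +ᴾ (0ℚ ∷ Dᴾ p *ᴾ q)) +ᴾ (a ∷ p) *ᴾ Dᴾ q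
    ≈⟨ +ᴾ-congˡ ((a ∷ p) *ᴾ Dᴾ q) (+ᴾ-congʳ (p *ᴾ q) (0∷-*ᴾ (Dᴾ p) q)) ⟨
  (p *ᴾ q +ᴾ (0ℚ ∷ Dᴾ p) *ᴾ q) +ᴾ (a ∷ p) *ᴾ Dᴾ q
    ≈⟨ +ᴾ-congˡ ((a ∷ p) *ᴾ Dᴾ q) (*ᴾ-distribʳ-+ᴾ q p (0ℚ ∷ Dᴾ p)) ⟨
  (p +ᴾ (0ℚ ∷ Dᴾ p)) *ᴾ q +ᴾ (a ∷ p) *ᴾ Dᴾ q
    ≈⟨ +ᴾ-congˡ ((a ∷ p) *ᴾ Dᴾ q) (*ᴾ-congˡ q (Dᴾ-∷ a p)) ⟨
  Dᴾ (a ∷ p) *ᴾ q +ᴾ (a ∷ p) *ᴾ Dᴾ q ∎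
  where
  open ≋-Reasoning
  open PolySolver

-- Rational functions and simple fractions

-- The embedding of ℕ into ℚ. As an iterated sum it makes `const (ι (suc m))` unfold to
-- `1ᴾ +ᴾ const (ι m)`, on which later identities rely.
ι : ℕ → ℚ
ι m = m ×ℚ 1ℚ

infix 4 _≃_
record _≃_ (f g : RatFun) : Set where
  constructor mk≃
  field cross : num f *ᴾ den g ≋ num g *ᴾ den f

open _≃_

≃-sym : ∀ {f g} → f ≃ g → g ≃ f
≃-sym e = mk≃ (≋-sym (cross e))

*ᴾ-cancelˡ : ∀ s p q → s ≉ᴾ 0ᴾ → s *ᴾ p ≋ s *ᴾ q → p ≋ q
*ᴾ-cancelˡ s p q s≉0 e = conclude (*ᴾ-zeroProduct s (p +ᴾ (-ᴾ q)) (at diff≋0))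
  where
  open ≋-Reasoning
  open PolySolver
  diff≋0 : s *ᴾ (p +ᴾ (-ᴾ q)) ≋ 0ᴾ
  diff≋0 = begin
    s *ᴾ (p +ᴾ (-ᴾ q))       ≈⟨ solve 3 (λ s p q → s :* (p :- q) := s :* p :- s :* q) ≋-refl s p q ⟩
    s *ᴾ p +ᴾ (-ᴾ (s *ᴾ q))  ≈⟨ +ᴾ-congˡ (-ᴾ (s *ᴾ q)) e ⟩
    s *ᴾ q +ᴾ (-ᴾ (s *ᴾ q))  ≈⟨ -ᴾ-inverseʳ (s *ᴾ q) ⟩
    0ᴾ ∎
  conclude : (s ≈ᴾ 0ᴾ) ⊎ (p +ᴾ (-ᴾ q) ≈ᴾ 0ᴾ) → p ≋ q
  conclude (inj₁ s≈0) = ⊥-elim (s≉0 s≈0)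
  conclude (inj₂ d≈0) = begin
    p                   ≈⟨ solve 2 (λ p q → p := (p :- q) :+ q) ≋-refl p q ⟩
    (p +ᴾ (-ᴾ q)) +ᴾ q  ≈⟨ +ᴾ-congˡ q (mk≋ d≈0) ⟩
    q ∎

-- Both sides are multiplied by the middle denominator `s`, which is nonzero and can be cancelled
-- again.
≃-trans : ∀ {f g h} → f ≃ g → g ≃ h → f ≃ h
≃-trans {mkRatFun p q _} {mkRatFun r s s≉0} {mkRatFun t u _} (mk≃ ps≋rq) (mk≃ ru≋ts) =
  mk≃ (*ᴾ-cancelˡ s (p *ᴾ u) (t *ᴾ q) s≉0 (begin
    s *ᴾ (p *ᴾ u)  ≈⟨ solve 3 (λ s p u → s :* (p :* u) := (p :* s) :* u) ≋-refl s p u ⟩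
    (p *ᴾ s) *ᴾ u  ≈⟨ *ᴾ-congˡ u ps≋rq ⟩
    (r *ᴾ q) *ᴾ u  ≈⟨ solve 3 (λ r q u → (r :* q) :* u := (r :* u) :* q) ≋-refl r q u ⟩
    (r *ᴾ u) *ᴾ q  ≈⟨ *ᴾ-congˡ q ru≋ts ⟩
    (t *ᴾ s) *ᴾ q  ≈⟨ solve 3 (λ t s q → (t :* s) :* q := s :* (t :* q)) ≋-refl t s q ⟩
    s *ᴾ (t *ᴾ q) ∎))
  where
  open ≋-Reasoning
  open PolySolver

-- The derivative of p s ≋ r q makes the two sides agree without any cancellation.
xD-cong : ∀ {f g} → f ≃ g → xD f ≃ xD g
xD-cong {mkRatFun p q _} {mkRatFun r s _} (mk≃ ps≋rq) = mk≃ (begin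
  X *ᴾ (p′ *ᴾ q -ᴾ p *ᴾ q′) *ᴾ (1ᴾ *ᴾ (s *ᴾ s))
    ≈⟨ identity X p q s p′ q′ s′ ⟩
  X *ᴾ ((p′ *ᴾ s +ᴾ p *ᴾ s′) *ᴾ (q *ᴾ s) -ᴾ (p *ᴾ s) *ᴾ (s′ *ᴾ q +ᴾ q′ *ᴾ s))
    ≈⟨ *ᴾ-congʳ X (+ᴾ-cong (*ᴾ-congˡ (q *ᴾ s) derivative) (·ᴾ-congʳ (ℚ.- 1ℚ) (*ᴾ-congˡ (s′ *ᴾ q +ᴾ q′ *ᴾ s) ps≋rq))) ⟩
  X *ᴾ ((r′ *ᴾ q +ᴾ r *ᴾ q′) *ᴾ (q *ᴾ s) -ᴾ (r *ᴾ q) *ᴾ (s′ *ᴾ q +ᴾ q′ *ᴾ s))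
    ≈⟨ identity′ X r q s r′ q′ s′ ⟩
  X *ᴾ (r′ *ᴾ s -ᴾ r *ᴾ s′) *ᴾ (1ᴾ *ᴾ (q *ᴾ q)) ∎)
  where
  open ≋-Reasoning
  open PolySolver
  identity : ∀ x p q s p′ q′ s′ → x *ᴾ (p′ *ᴾ q -ᴾ p *ᴾ q′) *ᴾ (1ᴾ *ᴾ (s *ᴾ s))
    ≋ x *ᴾ ((p′ *ᴾ s +ᴾ p *ᴾ s′) *ᴾ (q *ᴾ s) -ᴾ (p *ᴾ s) *ᴾ (s′ *ᴾ q +ᴾ q′ *ᴾ s))
  identity = solve 7 (λ x p q s p′ q′ s′ →
    x :* (p′ :* q :- p :* q′) :* (con 1ℚ :* (s :* s))
      := x :* ((p′ :* s :+ p :* s′) :* (q :* s) :- (p :* s) :* (s′ :* q :+ q′ :* s))) ≋-refl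
  identity′ : ∀ x r q s r′ q′ s′ → x *ᴾ ((r′ *ᴾ q +ᴾ r *ᴾ q′) *ᴾ (q *ᴾ s) -ᴾ (r *ᴾ q) *ᴾ (s′ *ᴾ q +ᴾ q′ *ᴾ s))
    ≋ x *ᴾ (r′ *ᴾ s -ᴾ r *ᴾ s′) *ᴾ (1ᴾ *ᴾ (q *ᴾ q))
  identity′ = solve 7 (λ x r q s r′ q′ s′ →
    x :* ((r′ :* q :+ r :* q′) :* (q :* s) :- (r :* q) :* (s′ :* q :+ q′ :* s))
      := x :* (r′ :* s :- r :* s′) :* (con 1ℚ :* (q :* q))) ≋-refl
  p′ = Dᴾ p
  q′ = Dᴾ q
  r′ = Dᴾ r
  s′ = Dᴾ s
  derivative : p′ *ᴾ s +ᴾ p *ᴾ s′ ≋ r′ *ᴾ q +ᴾ r *ᴾ q′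
  derivative = ≋-trans (≋-sym (Dᴾ-*ᴾ p s)) (≋-trans (Dᴾ-cong ps≋rq) (Dᴾ-*ᴾ r q))

-- The logarithmic derivative of p ^ m is m p′ / p.
Dᴾ-^ᴾ : ∀ p c → Dᴾ p ≋ const c → ∀ m → Dᴾ (p ^ᴾ m) *ᴾ p ≋ const c *ᴾ (const (ι m) *ᴾ p ^ᴾ m)
Dᴾ-^ᴾ p c p′ zero    = ≋-sym (≋-trans (*ᴾ-congʳ (const c) (*ᴾ-congˡ 1ᴾ 0∷0≋0)) (*ᴾ-zeroʳ (const c)))
Dᴾ-^ᴾ p c p′ (suc m) = begin
  Dᴾ (p *ᴾ p ^ᴾ m) *ᴾ p
    ≈⟨ *ᴾ-congˡ p (Dᴾ-*ᴾ p (p ^ᴾ m)) ⟩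
  (Dᴾ p *ᴾ p ^ᴾ m +ᴾ p *ᴾ Dᴾ (p ^ᴾ m)) *ᴾ p
    ≈⟨ solve 4 (λ p p′ q q′ → (p′ :* q :+ p :* q′) :* p := p′ :* (p :* q) :+ p :* (q′ :* p)) ≋-refl
         p (Dᴾ p) (p ^ᴾ m) (Dᴾ (p ^ᴾ m)) ⟩
  Dᴾ p *ᴾ (p *ᴾ p ^ᴾ m) +ᴾ p *ᴾ (Dᴾ (p ^ᴾ m) *ᴾ p)
    ≈⟨ +ᴾ-cong (*ᴾ-congˡ (p *ᴾ p ^ᴾ m) p′) (*ᴾ-congʳ p (Dᴾ-^ᴾ p c p′ m)) ⟩
  const c *ᴾ (p *ᴾ p ^ᴾ m) +ᴾ p *ᴾ (const c *ᴾ (const (ι m) *ᴾ p ^ᴾ m))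
    ≈⟨ identity p (p ^ᴾ m) (const c) (const (ι m)) ⟩
  const c *ᴾ (const (ι (suc m)) *ᴾ (p *ᴾ p ^ᴾ m)) ∎
  where
  open ≋-Reasoning
  open PolySolver
  identity : ∀ p q c i → c *ᴾ (p *ᴾ q) +ᴾ p *ᴾ (c *ᴾ (i *ᴾ q)) ≋ c *ᴾ ((1ᴾ +ᴾ i) *ᴾ (p *ᴾ q))
  identity = solve 4 (λ p q c i → c :* (p :* q) :+ p :* (c :* (i :* q)) := c :* ((con 1ℚ :+ i) :* (p :* q))) ≋-refl

Dᴾ-1-X : Dᴾ 1-X ≋ const (ℚ.- 1ℚ)
Dᴾ-1-X = ≋-refl

Dᴾ-X : Dᴾ X ≋ 1ᴾ
Dᴾ-X = ≋-refl

Dᴾ-const* : ∀ c p → Dᴾ (const c *ᴾ p) ≋ const c *ᴾ Dᴾ p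
Dᴾ-const* c p = Dᴾ-*ᴾ (const c) p

-- What the quotient rule leaves of p/(1-x)^m over the denominator (1-x)^(m+1) instead of
-- (1-x)^(2m).
xD-numerator : ℕ → Poly → Poly
xD-numerator m p = X *ᴾ (Dᴾ p *ᴾ 1-X +ᴾ const (ι m) *ᴾ p)

-- Cross-multiplication supplies a factor 1-x next to the derivative of (1-x)^m, so `Dᴾ-^ᴾ` can
-- replace their product by -m (1-x)^m without any division.
xD-/[1-x]^ : ∀ p m → xD (p /[1-x]^ m) ≃ xD-numerator m p /[1-x]^ (suc m)
xD-/[1-x]^ p m = mk≃ (begin
  X *ᴾ (Dᴾ p *ᴾ Y -ᴾ p *ᴾ Dᴾ Y) *ᴾ (1-X *ᴾ Y)
    ≈⟨ identity X p (Dᴾ p) Y (Dᴾ Y) 1-X ⟩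
  X *ᴾ (Dᴾ p *ᴾ Y *ᴾ 1-X -ᴾ p *ᴾ (Dᴾ Y *ᴾ 1-X)) *ᴾ Y
    ≈⟨ *ᴾ-congˡ Y (*ᴾ-congʳ X (+ᴾ-congʳ (Dᴾ p *ᴾ Y *ᴾ 1-X) (·ᴾ-congʳ (ℚ.- 1ℚ) (*ᴾ-congʳ p (Dᴾ-^ᴾ 1-X (ℚ.- 1ℚ) Dᴾ-1-X m))))) ⟩
  X *ᴾ (Dᴾ p *ᴾ Y *ᴾ 1-X -ᴾ p *ᴾ (const (ℚ.- 1ℚ) *ᴾ (const (ι m) *ᴾ Y))) *ᴾ Y
    ≈⟨ identity′ X p (Dᴾ p) Y (const (ι m)) 1-X ⟩
  xD-numerator m p *ᴾ (1ᴾ *ᴾ (Y *ᴾ Y)) ∎)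
  where
  open ≋-Reasoning
  open PolySolver
  Y = 1-X ^ᴾ m
  identity : ∀ x p p′ Y Y′ y →
    x *ᴾ (p′ *ᴾ Y -ᴾ p *ᴾ Y′) *ᴾ (y *ᴾ Y) ≋ x *ᴾ (p′ *ᴾ Y *ᴾ y -ᴾ p *ᴾ (Y′ *ᴾ y)) *ᴾ Y
  identity = solve 6 (λ x p p′ Y Y′ y →
    x :* (p′ :* Y :- p :* Y′) :* (y :* Y) := x :* (p′ :* Y :* y :- p :* (Y′ :* y)) :* Y) ≋-refl
  identity′ : ∀ x p p′ Y i y →
    x *ᴾ (p′ *ᴾ Y *ᴾ y -ᴾ p *ᴾ (const (ℚ.- 1ℚ) *ᴾ (i *ᴾ Y))) *ᴾ Y
      ≋ x *ᴾ (p′ *ᴾ y +ᴾ i *ᴾ p) *ᴾ (1ᴾ *ᴾ (Y *ᴾ Y))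
  identity′ = solve 6 (λ x p p′ Y i y →
    x :* (p′ :* Y :* y :- p :* (con (ℚ.- 1ℚ) :* (i :* Y))) :* Y
      := x :* (p′ :* y :+ i :* p) :* (con 1ℚ :* (Y :* Y))) ≋-refl

-- H j a = Σ_{k ≤ j} aₖ xᵏ (1 - x)ʲ⁻ᵏ, the numerator of Σ_{k ≤ j} aₖ xᵏ/(1 - x)ⁿ⁺ᵏ over (1 - x)ⁿ⁺ʲ.
H : ℕ → (ℕ → ℚ) → Poly
H zero    a = const (a 0)
H (suc j) a = const (a 0) *ᴾ 1-X ^ᴾ suc j +ᴾ X *ᴾ H j (a ∘ suc)

-- The definition of `H` splits off the first coefficient, which suits injectivity. Splitting off
-- the last one suits the induction in `H-next`: raising the exponent of the common denominator by
-- one multiplies the old numerator by 1-x and adds a single new term.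
H-last : ∀ j a → H (suc j) a ≋ 1-X *ᴾ H j a +ᴾ const (a (suc j)) *ᴾ X ^ᴾ suc j
H-last zero    a = identity (const (a 0)) (const (a 1)) X 1-X
  where
  open PolySolver
  identity : ∀ a b x y → a *ᴾ (y *ᴾ 1ᴾ) +ᴾ x *ᴾ b ≋ y *ᴾ a +ᴾ b *ᴾ (x *ᴾ 1ᴾ)
  identity = solve 4 (λ a b x y → a :* (y :* con 1ℚ) :+ x :* b := y :* a :+ b :* (x :* con 1ℚ)) ≋-refl
H-last (suc j) a = begin
  const (a 0) *ᴾ (1-X *ᴾ Y) +ᴾ X *ᴾ H (suc j) (a ∘ suc)
    ≈⟨ +ᴾ-congʳ (const (a 0) *ᴾ (1-X *ᴾ Y)) (*ᴾ-congʳ X (H-last j (a ∘ suc))) ⟩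
  const (a 0) *ᴾ (1-X *ᴾ Y) +ᴾ X *ᴾ (1-X *ᴾ H j (a ∘ suc) +ᴾ const (a (suc (suc j))) *ᴾ X ^ᴾ suc j)
    ≈⟨ identity (const (a 0)) (const (a (suc (suc j)))) X 1-X Y (H j (a ∘ suc)) (X ^ᴾ suc j) ⟩
  1-X *ᴾ (const (a 0) *ᴾ Y +ᴾ X *ᴾ H j (a ∘ suc)) +ᴾ const (a (suc (suc j))) *ᴾ (X *ᴾ X ^ᴾ suc j) ∎
  where
  open ≋-Reasoning
  open PolySolver
  Y = 1-X ^ᴾ suc j
  identity : ∀ a b x y Y h z →
    a *ᴾ (y *ᴾ Y) +ᴾ x *ᴾ (y *ᴾ h +ᴾ b *ᴾ z) ≋ y *ᴾ (a *ᴾ Y +ᴾ x *ᴾ h) +ᴾ b *ᴾ (x *ᴾ z)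
  identity = solve 7 (λ a b x y Y h z →
    a :* (y :* Y) :+ x :* (y :* h :+ b :* z) := y :* (a :* Y :+ x :* h) :+ b :* (x :* z)) ≋-refl

-- The action of xD on the coefficient sequence with respect to the fractions x^k/(1-x)^(n+k).
next : ℕ → (ℕ → ℚ) → ℕ → ℚ
next n a zero    = 0ℚ
next n a (suc k) = ι (suc k) ℚ.* a (suc k) ℚ.+ ι (n ℕ.+ k) ℚ.* a k

const-next : ∀ n a k → const (next n a (suc k)) ≋ const (ι (suc k)) *ᴾ const (a (suc k)) +ᴾ const (ι (n ℕ.+ k)) *ᴾ const (a k)
const-next n a k = +ᴾ-cong (const-* (ι (suc k)) (a (suc k))) (const-* (ι (n ℕ.+ k)) (a k))
  where
  const-* : ∀ a b → const (a ℚ.* b) ≋ const a *ᴾ const b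
  const-* a b = ∷-cong (sym (ℚₚ.+-identityʳ (a ℚ.* b))) ≋-refl

-- The extra term on the left compensates for a_{j+1}, which enters next n a but not H j a.
H-next : ∀ n j a →
  xD-numerator (n ℕ.+ j) (H j a) +ᴾ const (ι (suc j)) *ᴾ (const (a (suc j)) *ᴾ X ^ᴾ suc j) ≋ H (suc j) (next n a)
H-next n zero a = begin
  X *ᴾ (0ᴾ +ᴾ const i *ᴾ a₀) +ᴾ const (ι 1) *ᴾ (a₁ *ᴾ (X *ᴾ 1ᴾ))
    ≈⟨ identity X 1-X a₀ a₁ (const i) (const (ι 1)) ⟩
  const 0ℚ *ᴾ (1-X *ᴾ 1ᴾ) +ᴾ X *ᴾ (const (ι 1) *ᴾ a₁ +ᴾ const i *ᴾ a₀)
    ≈⟨ +ᴾ-congʳ (const 0ℚ *ᴾ (1-X *ᴾ 1ᴾ)) (*ᴾ-congʳ X (const-next n a 0)) ⟨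
  const 0ℚ *ᴾ (1-X *ᴾ 1ᴾ) +ᴾ X *ᴾ const (next n a 1) ∎
  where
  open ≋-Reasoning
  open PolySolver
  a₀ = const (a 0)
  a₁ = const (a 1)
  i = ι (n ℕ.+ 0)
  identity : ∀ x y a b i o →
    x *ᴾ (0ᴾ +ᴾ i *ᴾ a) +ᴾ o *ᴾ (b *ᴾ (x *ᴾ 1ᴾ)) ≋ const 0ℚ *ᴾ (y *ᴾ 1ᴾ) +ᴾ x *ᴾ (o *ᴾ b +ᴾ i *ᴾ a)
  identity = solve 6 (λ x y a b i o →
    x :* (i :* a) :+ o :* (b :* (x :* con 1ℚ)) := con 0ℚ :* (y :* con 1ℚ) :+ x :* (o :* b :+ i :* a)) ≋-refl
H-next n (suc j) a = begin
  xD-numerator (n ℕ.+ suc j) (H (suc j) a) +ᴾ w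
    ≈⟨ +ᴾ-congˡ w (*ᴾ-congʳ X (+ᴾ-cong (*ᴾ-congˡ 1-X derivative) (*ᴾ-cong ι-suc (H-last j a)))) ⟩
  X *ᴾ (((const (ℚ.- 1ℚ) *ᴾ h +ᴾ 1-X *ᴾ Dᴾ h) +ᴾ b *ᴾ Dᴾ (X ^ᴾ suc j)) *ᴾ 1-X +ᴾ (1ᴾ +ᴾ i) *ᴾ (1-X *ᴾ h +ᴾ b *ᴾ X ^ᴾ suc j)) +ᴾ w
    ≈⟨ +ᴾ-congˡ w (identity X 1-X h (Dᴾ h) b (X ^ᴾ suc j) (Dᴾ (X ^ᴾ suc j)) i) ⟩
  1-X *ᴾ (X *ᴾ (Dᴾ h *ᴾ 1-X +ᴾ i *ᴾ h) +ᴾ b *ᴾ (Dᴾ (X ^ᴾ suc j) *ᴾ X)) +ᴾ (1ᴾ +ᴾ i) *ᴾ (b *ᴾ (X *ᴾ X ^ᴾ suc j)) +ᴾ w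
    ≈⟨ +ᴾ-congˡ w (+ᴾ-cong
         (*ᴾ-congʳ 1-X (+ᴾ-congʳ (X *ᴾ (Dᴾ h *ᴾ 1-X +ᴾ i *ᴾ h)) (*ᴾ-congʳ b (Dᴾ-^ᴾ X 1ℚ Dᴾ-X (suc j)))))
         (*ᴾ-congˡ (b *ᴾ (X *ᴾ X ^ᴾ suc j)) (≋-sym ι-suc))) ⟩
  1-X *ᴾ (X *ᴾ (Dᴾ h *ᴾ 1-X +ᴾ i *ᴾ h) +ᴾ b *ᴾ (1ᴾ *ᴾ (const (ι (suc j)) *ᴾ X ^ᴾ suc j))) +ᴾ const (ι (n ℕ.+ suc j)) *ᴾ (b *ᴾ (X *ᴾ X ^ᴾ suc j)) +ᴾ w
    ≈⟨ identity′ 1-X (X *ᴾ (Dᴾ h *ᴾ 1-X +ᴾ i *ᴾ h)) b (const (ι (suc j))) (X ^ᴾ suc j) (const (ι (n ℕ.+ suc j)))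
         (X ^ᴾ suc (suc j)) (const (ι (suc (suc j)))) (const (a (suc (suc j)))) ⟩
  1-X *ᴾ (X *ᴾ (Dᴾ h *ᴾ 1-X +ᴾ i *ᴾ h) +ᴾ const (ι (suc j)) *ᴾ (b *ᴾ X ^ᴾ suc j))
    +ᴾ (const (ι (suc (suc j))) *ᴾ const (a (suc (suc j))) +ᴾ const (ι (n ℕ.+ suc j)) *ᴾ b) *ᴾ X ^ᴾ suc (suc j)
    ≈⟨ +ᴾ-cong (*ᴾ-congʳ 1-X (H-next n j a)) (*ᴾ-congˡ (X ^ᴾ suc (suc j)) (≋-sym (const-next n a (suc j)))) ⟩
  1-X *ᴾ H (suc j) (next n a) +ᴾ const (next n a (suc (suc j))) *ᴾ X ^ᴾ suc (suc j)
    ≈⟨ H-last (suc j) (next n a) ⟨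
  H (suc (suc j)) (next n a) ∎
  where
  open ≋-Reasoning
  open PolySolver
  h = H j a
  b = const (a (suc j))
  i = const (ι (n ℕ.+ j))
  w = const (ι (suc (suc j))) *ᴾ (const (a (suc (suc j))) *ᴾ X ^ᴾ suc (suc j))
  ι-suc : const (ι (n ℕ.+ suc j)) ≋ 1ᴾ +ᴾ i
  ι-suc = ∷-cong (cong ι (ℕₚ.+-suc n j)) ≋-refl
  derivative : Dᴾ (H (suc j) a) ≋ (const (ℚ.- 1ℚ) *ᴾ h +ᴾ 1-X *ᴾ Dᴾ h) +ᴾ b *ᴾ Dᴾ (X ^ᴾ suc j)
  derivative = begin
    Dᴾ (H (suc j) a)                              ≈⟨ Dᴾ-cong (H-last j a) ⟩
    Dᴾ (1-X *ᴾ h +ᴾ b *ᴾ X ^ᴾ suc j)              ≈⟨ Dᴾ-+ᴾ (1-X *ᴾ h) (b *ᴾ X ^ᴾ suc j) ⟩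
    Dᴾ (1-X *ᴾ h) +ᴾ Dᴾ (b *ᴾ X ^ᴾ suc j)         ≈⟨ +ᴾ-cong (Dᴾ-*ᴾ 1-X h) (Dᴾ-const* (a (suc j)) (X ^ᴾ suc j)) ⟩
    (Dᴾ 1-X *ᴾ h +ᴾ 1-X *ᴾ Dᴾ h) +ᴾ b *ᴾ Dᴾ (X ^ᴾ suc j)
      ≈⟨ +ᴾ-congˡ (b *ᴾ Dᴾ (X ^ᴾ suc j)) (+ᴾ-congˡ (1-X *ᴾ Dᴾ h) (*ᴾ-congˡ h Dᴾ-1-X)) ⟩
    (const (ℚ.- 1ℚ) *ᴾ h +ᴾ 1-X *ᴾ Dᴾ h) +ᴾ b *ᴾ Dᴾ (X ^ᴾ suc j) ∎
  identity : ∀ x y h h′ b z z′ i →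
    x *ᴾ (((const (ℚ.- 1ℚ) *ᴾ h +ᴾ y *ᴾ h′) +ᴾ b *ᴾ z′) *ᴾ y +ᴾ (1ᴾ +ᴾ i) *ᴾ (y *ᴾ h +ᴾ b *ᴾ z))
      ≋ y *ᴾ (x *ᴾ (h′ *ᴾ y +ᴾ i *ᴾ h) +ᴾ b *ᴾ (z′ *ᴾ x)) +ᴾ (1ᴾ +ᴾ i) *ᴾ (b *ᴾ (x *ᴾ z))
  identity = solve 8 (λ x y h h′ b z z′ i →
    x :* (((con (ℚ.- 1ℚ) :* h :+ y :* h′) :+ b :* z′) :* y :+ (con 1ℚ :+ i) :* (y :* h :+ b :* z))
      := y :* (x :* (h′ :* y :+ i :* h) :+ b :* (z′ :* x)) :+ (con 1ℚ :+ i) :* (b :* (x :* z))) ≋-refl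
  identity′ : ∀ y u b s z m Z t c →
    y *ᴾ (u +ᴾ b *ᴾ (1ᴾ *ᴾ (s *ᴾ z))) +ᴾ m *ᴾ (b *ᴾ Z) +ᴾ t *ᴾ (c *ᴾ Z)
      ≋ y *ᴾ (u +ᴾ s *ᴾ (b *ᴾ z)) +ᴾ (t *ᴾ c +ᴾ m *ᴾ b) *ᴾ Z
  identity′ = solve 9 (λ y u b s z m Z t c →
    y :* (u :+ b :* (con 1ℚ :* (s :* z))) :+ m :* (b :* Z) :+ t :* (c :* Z)
      := y :* (u :+ s :* (b :* z)) :+ (t :* c :+ m :* b) :* Z) ≋-refl

-- Existence and uniqueness of the expansion in simple fractions

const-cong : ∀ {a b} → a ≡ b → const a ≋ const b
const-cong a≡b = ∷-cong a≡b ≋-refl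

coefficients : ℕ → ℕ → ℕ → ℚ
coefficients n zero    zero    = 1ℚ
coefficients n zero    (suc k) = 0ℚ
coefficients n (suc j) k       = next n (coefficients n j) k

coefficients-degree : ∀ n j {k} → j ℕ.< k → coefficients n j k ≡ 0ℚ
coefficients-degree n zero    {suc k} _         = refl
coefficients-degree n (suc j) {suc k} (ℕ.s≤s j<k) = trans
  (cong₂ (λ x y → ι (suc k) ℚ.* x ℚ.+ ι (n ℕ.+ k) ℚ.* y)
     (coefficients-degree n j (ℕₚ.m<n⇒m<1+n j<k)) (coefficients-degree n j j<k))
  (trans (cong₂ ℚ._+_ (ℚₚ.*-zeroʳ (ι (suc k))) (ℚₚ.*-zeroʳ (ι (n ℕ.+ k)))) (ℚₚ.+-identityʳ 0ℚ))

iterate-suc : ∀ {A : Set} (f : A → A) x j → iterate f x (suc j) ≡ f (iterate f x j)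
iterate-suc f x zero    = refl
iterate-suc f x (suc j) = iterate-suc f (f x) j

/[1-x]^-cong : ∀ m {p q} → p ≋ q → p /[1-x]^ m ≃ q /[1-x]^ m
/[1-x]^-cong m e = mk≃ (*ᴾ-congˡ (1-X ^ᴾ m) e)

iterate-xD : ∀ n j → iterate xD (1ᴾ /[1-x]^ n) j ≃ H j (coefficients n j) /[1-x]^ (n ℕ.+ j)
iterate-xD n zero    = subst (λ m → 1ᴾ /[1-x]^ n ≃ 1ᴾ /[1-x]^ m) (sym (ℕₚ.+-identityʳ n)) (/[1-x]^-cong n ≋-refl)
iterate-xD n (suc j) =
  subst₂ (λ f m → f ≃ H (suc j) (next n c) /[1-x]^ m)
    (sym (iterate-suc xD (1ᴾ /[1-x]^ n) j)) (sym (ℕₚ.+-suc n j))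
    (≃-trans (xD-cong (iterate-xD n j))
    (≃-trans (xD-/[1-x]^ (H j c) (n ℕ.+ j)) (/[1-x]^-cong (suc (n ℕ.+ j)) numerator)))
  where
  open ≋-Reasoning
  c = coefficients n j
  P = xD-numerator (n ℕ.+ j) (H j c)
  Q = X ^ᴾ suc j
  I = const (ι (suc j))
  -- The compensating term of `H-next` is zero here, because `coefficients n j` vanishes beyond
  -- index j.
  numerator : P ≋ H (suc j) (next n c)
  numerator = begin
    P                              ≈⟨ +ᴾ-identityʳ P ⟨
    P +ᴾ 0ᴾ                        ≈⟨ +ᴾ-congʳ P (*ᴾ-zeroʳ I) ⟨
    P +ᴾ I *ᴾ (0ᴾ *ᴾ Q)
      ≈⟨ +ᴾ-congʳ P (*ᴾ-congʳ I (*ᴾ-congˡ Q (≋-trans (const-cong (coefficients-degree n j (ℕₚ.n<1+n j))) 0∷0≋0))) ⟨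
    P +ᴾ I *ᴾ (const (c (suc j)) *ᴾ Q) ≈⟨ H-next n j c ⟩
    H (suc j) (next n c) ∎

^ᴾ-+ : ∀ p m k → p ^ᴾ (m ℕ.+ k) ≋ p ^ᴾ m *ᴾ p ^ᴾ k
^ᴾ-+ p zero    k = ≋-sym (*ᴾ-identityˡ (p ^ᴾ k))
^ᴾ-+ p (suc m) k = ≋-trans (*ᴾ-congʳ p (^ᴾ-+ p m k)) (≋-sym (*ᴾ-assoc p (p ^ᴾ m) (p ^ᴾ k)))

-- Addition in `RatFun` multiplies denominators, so the sum on the left comes with a large product
-- as its denominator. The exponent `d k` is what the k-th term lacks to the common exponent `M`.
sum-/[1-x]^ : ∀ {m} (p : Fin m → Poly) (e d : Fin m → ℕ) M → (∀ k → e k ℕ.+ d k ≡ M) →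
  Defs.sum (λ k → p k /[1-x]^ e k) ≃ sumᴾ (λ k → p k *ᴾ 1-X ^ᴾ d k) /[1-x]^ M
sum-/[1-x]^ {zero}  p e d M e+d≡M = mk≃ ≋-refl
sum-/[1-x]^ {suc m} p e d M e+d≡M = mk≃ (begin
  (p₀ *ᴾ den r +ᴾ num r *ᴾ Yₑ) *ᴾ 1-X ^ᴾ M
    ≈⟨ solve 5 (λ p d n e M → (p :* d :+ n :* e) :* M := p :* d :* M :+ (n :* M) :* e) ≋-refl
         p₀ (den r) (num r) Yₑ (1-X ^ᴾ M) ⟩
  p₀ *ᴾ den r *ᴾ 1-X ^ᴾ M +ᴾ (num r *ᴾ 1-X ^ᴾ M) *ᴾ Yₑ
    ≈⟨ +ᴾ-cong (*ᴾ-congʳ (p₀ *ᴾ den r) split) (*ᴾ-congˡ Yₑ (cross (sum-/[1-x]^ (p ∘ Fin.suc) (e ∘ Fin.suc) (d ∘ Fin.suc) M (e+d≡M ∘ Fin.suc)))) ⟩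
  p₀ *ᴾ den r *ᴾ (Yₑ *ᴾ Y) +ᴾ (S *ᴾ den r) *ᴾ Yₑ
    ≈⟨ solve 5 (λ p d e y S → p :* d :* (e :* y) :+ (S :* d) :* e := (p :* y :+ S) :* (e :* d)) ≋-refl
         p₀ (den r) Yₑ Y S ⟩
  (p₀ *ᴾ Y +ᴾ S) *ᴾ (Yₑ *ᴾ den r) ∎)
  where
  open ≋-Reasoning
  open PolySolver
  p₀ = p Fin.zero
  r  = Defs.sum (λ k → p (Fin.suc k) /[1-x]^ e (Fin.suc k))
  S  = sumᴾ (λ k → p (Fin.suc k) *ᴾ 1-X ^ᴾ d (Fin.suc k))
  Yₑ = 1-X ^ᴾ e Fin.zero
  Y  = 1-X ^ᴾ d Fin.zero
  split : 1-X ^ᴾ M ≋ Yₑ *ᴾ Y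
  split = subst (λ m → 1-X ^ᴾ m ≋ Yₑ *ᴾ Y) (e+d≡M Fin.zero) (^ᴾ-+ 1-X (e Fin.zero) (d Fin.zero))

-- Padding with zeros makes coefficients indexed by `Fin m` comparable with the sequences that `H`
-- takes, and with the coefficients of a polynomial at every index.
extend : ∀ {m} → (Fin m → ℚ) → ℕ → ℚ
extend {zero}  a k       = 0ℚ
extend {suc m} a zero    = a Fin.zero
extend {suc m} a (suc k) = extend (a ∘ Fin.suc) k

extend-≡ : ∀ {m} {a : Fin m → ℚ} {f : ℕ → ℚ} → (∀ i → f (toℕ i) ≡ a i) → (∀ {k} → m ℕ.≤ k → f k ≡ 0ℚ) →
  ∀ k → extend a k ≡ f k
extend-≡ {zero}  e z k       = sym (z ℕ.z≤n)
extend-≡ {suc m} e z zero    = sym (e Fin.zero)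
extend-≡ {suc m} e z (suc k) = extend-≡ (e ∘ Fin.suc) (z ∘ ℕ.s≤s) k

extend-toℕ : ∀ {m} (a : Fin m → ℚ) i → extend a (toℕ i) ≡ a i
extend-toℕ a Fin.zero    = refl
extend-toℕ a (Fin.suc i) = extend-toℕ (a ∘ Fin.suc) i

sumᴾ-cong : ∀ {m} {f g : Fin m → Poly} → (∀ k → f k ≋ g k) → sumᴾ f ≋ sumᴾ g
sumᴾ-cong {zero}  e = ≋-refl
sumᴾ-cong {suc m} e = +ᴾ-cong (e Fin.zero) (sumᴾ-cong (e ∘ Fin.suc))

*ᴾ-distribˡ-sumᴾ : ∀ p {m} (f : Fin m → Poly) → sumᴾ (λ k → p *ᴾ f k) ≋ p *ᴾ sumᴾ f
*ᴾ-distribˡ-sumᴾ p {zero}  f = ≋-sym (*ᴾ-zeroʳ p)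
*ᴾ-distribˡ-sumᴾ p {suc m} f = ≋-trans (+ᴾ-congʳ (p *ᴾ f Fin.zero) (*ᴾ-distribˡ-sumᴾ p (f ∘ Fin.suc)))
  (≋-sym (CommutativeRing.distribˡ Poly-commutativeRing p (f Fin.zero) (sumᴾ (f ∘ Fin.suc))))

sumᴾ-H : ∀ j (a : Fin (suc j) → ℚ) →
  sumᴾ (λ k → monomial (a k) (toℕ k) *ᴾ 1-X ^ᴾ (j ℕ.∸ toℕ k)) ≋ H j (extend a)
sumᴾ-H zero a = identity (const (a Fin.zero))
  where
  open PolySolver
  identity : ∀ a → a *ᴾ 1ᴾ *ᴾ 1ᴾ +ᴾ 0ᴾ ≋ a
  identity a = ≋-trans (+ᴾ-identityʳ (a *ᴾ 1ᴾ *ᴾ 1ᴾ)) (solve 1 (λ a → a :* con 1ℚ :* con 1ℚ := a) ≋-refl a)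
sumᴾ-H (suc j) a = +ᴾ-cong
  (*ᴾ-congˡ (1-X ^ᴾ suc j) (CommutativeRing.*-identityʳ Poly-commutativeRing (const (a Fin.zero))))
  (≋-trans (sumᴾ-cong (λ k → shift (const (a (Fin.suc k))) X (X ^ᴾ toℕ k) (1-X ^ᴾ (j ℕ.∸ toℕ k))))
  (≋-trans (*ᴾ-distribˡ-sumᴾ X (λ k → monomial (a (Fin.suc k)) (toℕ k) *ᴾ 1-X ^ᴾ (j ℕ.∸ toℕ k)))
  (*ᴾ-congʳ X (sumᴾ-H j (a ∘ Fin.suc)))))
  where
  open PolySolver
  shift : ∀ a x z y → a *ᴾ (x *ᴾ z) *ᴾ y ≋ x *ᴾ (a *ᴾ z *ᴾ y)
  shift = solve 4 (λ a x z y → a :* (x :* z) :* y := x :* (a :* z :* y)) ≋-refl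

H-cong : ∀ j {a b} → (∀ k → k ℕ.≤ j → a k ≡ b k) → H j a ≋ H j b
H-cong zero    e = ∷-cong (e 0 ℕ.z≤n) ≋-refl
H-cong (suc j) e = +ᴾ-cong (*ᴾ-congˡ (1-X ^ᴾ suc j) (const-cong (e 0 ℕ.z≤n)))
  (*ᴾ-congʳ X (H-cong j (λ k k≤j → e (suc k) (ℕ.s≤s k≤j))))

X-nonZero : X ≉ᴾ 0ᴾ
X-nonZero eq with eq 1
... | ()

coeff-0-* : ∀ p q → coeff (p *ᴾ q) 0 ≡ coeff p 0 ℚ.* coeff q 0
coeff-0-* []      q = sym (ℚₚ.*-zeroˡ (coeff q 0))
coeff-0-* (a ∷ p) q = trans (coeff-∷* a p q 0) (ℚₚ.+-identityʳ _)

coeff-0-[1-X]^ : ∀ m → coeff (1-X ^ᴾ m) 0 ≡ 1ℚ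
coeff-0-[1-X]^ zero    = refl
coeff-0-[1-X]^ (suc m) = trans (coeff-0-* 1-X (1-X ^ᴾ m)) (cong (1ℚ ℚ.*_) (coeff-0-[1-X]^ m))

H-0 : ∀ j a → coeff (H j a) 0 ≡ a 0
H-0 zero    a = refl
H-0 (suc j) a = begin
  coeff (const (a 0) *ᴾ 1-X ^ᴾ suc j +ᴾ X *ᴾ H j (a ∘ suc)) 0
    ≡⟨ coeff-+ (const (a 0) *ᴾ 1-X ^ᴾ suc j) (X *ᴾ H j (a ∘ suc)) 0 ⟩
  coeff (const (a 0) *ᴾ 1-X ^ᴾ suc j) 0 ℚ.+ coeff (X *ᴾ H j (a ∘ suc)) 0
    ≡⟨ cong₂ ℚ._+_ (coeff-0-* (const (a 0)) (1-X ^ᴾ suc j)) (coeff-0-* X (H j (a ∘ suc))) ⟩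
  a 0 ℚ.* coeff (1-X ^ᴾ suc j) 0 ℚ.+ 0ℚ ℚ.* coeff (H j (a ∘ suc)) 0
    ≡⟨ cong₂ ℚ._+_ (cong (a 0 ℚ.*_) (coeff-0-[1-X]^ (suc j))) (ℚₚ.*-zeroˡ (coeff (H j (a ∘ suc)) 0)) ⟩
  a 0 ℚ.* 1ℚ ℚ.+ 0ℚ
    ≡⟨ trans (ℚₚ.+-identityʳ (a 0 ℚ.* 1ℚ)) (ℚₚ.*-identityʳ (a 0)) ⟩
  a 0 ∎
  where open ≡-Reasoning

-- Evaluation at 0 isolates `a 0`: all later terms have a factor x, and powers of 1-x become 1.
-- After this term and then one factor x are cancelled, the same argument applies to the shifted
-- sequences.
H-injective : ∀ j {a b} → H j a ≋ H j b → ∀ k → k ℕ.≤ j → a k ≡ b k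
H-injective j {a} {b} e zero _ = trans (sym (H-0 j a)) (trans (at e 0) (H-0 j b))
H-injective (suc j) {a} {b} e (suc k) (ℕ.s≤s k≤j) =
  H-injective j (*ᴾ-cancelˡ X _ _ X-nonZero (∙-cancelˡ (const (b 0) *ᴾ 1-X ^ᴾ suc j) _ _
    (≋-trans (+ᴾ-congˡ (X *ᴾ H j (a ∘ suc)) (*ᴾ-congˡ (1-X ^ᴾ suc j)
      (const-cong (sym (H-injective (suc j) {a} {b} e 0 ℕ.z≤n))))) e))) k k≤j
  where open GroupProperties (CommutativeRing.+-group Poly-commutativeRing) using (∙-cancelˡ)

expansion-sum : ∀ j (a : Fin (suc j) → ℚ) →
  Defs.sum (λ k → monomial (a k) (toℕ k) /[1-x]^ (suc j ℕ.+ toℕ k)) ≃ H j (extend a) /[1-x]^ (suc j ℕ.+ j)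
expansion-sum j a = ≃-trans
  (sum-/[1-x]^ (λ k → monomial (a k) (toℕ k)) (λ k → suc j ℕ.+ toℕ k) (λ k → j ℕ.∸ toℕ k) (suc j ℕ.+ j) exponents)
  (/[1-x]^-cong (suc j ℕ.+ j) (sumᴾ-H j a))
  where
  exponents : ∀ (k : Fin (suc j)) → suc j ℕ.+ toℕ k ℕ.+ (j ℕ.∸ toℕ k) ≡ suc j ℕ.+ j
  exponents k = trans (ℕₚ.+-assoc (suc j) (toℕ k) (j ℕ.∸ toℕ k))
    (cong (suc j ℕ.+_) (ℕₚ.m+[n∸m]≡n (Finₚ.toℕ≤pred[n] k)))

expansion-exists : ∀ j → IsSimpleFractionExpansion (suc j) (λ k → coefficients (suc j) j (toℕ k))
expansion-exists j = at (cross (≃-trans (iterate-xD (suc j) j)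
  (≃-trans (/[1-x]^-cong (suc j ℕ.+ j) (H-cong j (λ k _ → sym (extend-≡ (λ _ → refl) (coefficients-degree (suc j) j) k))))
  (≃-sym (expansion-sum j (λ k → coefficients (suc j) j (toℕ k)))))))

expansion-unique : ∀ j a → IsSimpleFractionExpansion (suc j) a → ∀ k → coefficients (suc j) j (toℕ k) ≡ a k
expansion-unique j a e k = trans (H-injective j numerators (toℕ k) (Finₚ.toℕ≤pred[n] k)) (extend-toℕ a k)
  where
  M = 1-X ^ᴾ (suc j ℕ.+ j)
  fractions : H j (coefficients (suc j) j) /[1-x]^ (suc j ℕ.+ j) ≃ H j (extend a) /[1-x]^ (suc j ℕ.+ j)
  fractions = ≃-trans (≃-sym (iterate-xD (suc j) j)) (≃-trans (mk≃ (mk≋ e)) (expansion-sum j a))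
  numerators : H j (coefficients (suc j) j) ≋ H j (extend a)
  numerators = *ᴾ-cancelˡ M _ _ (^ᴾ-nonZero 1-X (suc j ℕ.+ j) 1-X-nonZero)
    (≋-trans (*ᴾ-comm M _) (≋-trans (cross fractions) (*ᴾ-comm _ M)))

-- Stirling numbers and the counting recurrence

S : ℕ → ℕ → ℕ
S zero    zero    = 1
S zero    (suc k) = 0
S (suc m) zero    = 0
S (suc m) (suc k) = suc k * S m (suc k) + S m k

rising : ℕ → ℕ → ℕ
rising x zero    = 1
rising x (suc k) = rising x k * (x + k)

-- The definition splits off the last factor, as the recursion of the coefficients requires; the
-- forest recurrence and the choice of a root require the first one.
rising-suc : ∀ x k → rising x (suc k) ≡ x * rising (suc x) k
rising-suc x zero    = solve 1 (λ x → con 1 :* (x :+ con 0) := x :* con 1) refl x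
  where open +-*-Solver
rising-suc x (suc k) = begin
  rising x (suc k) * (x + suc k)      ≡⟨ cong₂ _*_ (rising-suc x k) (+-suc x k) ⟩
  x * rising (suc x) k * (suc x + k)  ≡⟨ *-assoc x (rising (suc x) k) (suc x + k) ⟩
  x * rising (suc x) (suc k) ∎
  where open ≡-Reasoning

-- Σ g (r + |B|) (m - |B|) over the subsets B (over the nonempty ones) of an m-element set.
Σ⊆ Σ⁺⊆ : (ℕ → ℕ → ℕ) → ℕ → ℕ → ℕ
Σ⊆  g r zero    = g r 0
Σ⊆  g r (suc m) = Σ⊆ (λ r′ m′ → g r′ (suc m′)) r m + Σ⊆ g (suc r) m
Σ⁺⊆ g r zero    = 0
Σ⁺⊆ g r (suc m) = Σ⁺⊆ (λ r′ m′ → g r′ (suc m′)) r m + Σ⊆ g (suc r) m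

-- Identities for sums over nonempty subsets are obtained from those over all subsets by cancelling
-- the summand of the empty set.
Σ⊆≡+Σ⁺⊆ : ∀ g r m → Σ⊆ g r m ≡ g r m + Σ⁺⊆ g r m
Σ⊆≡+Σ⁺⊆ g r zero    = sym (+-identityʳ (g r 0))
Σ⊆≡+Σ⁺⊆ g r (suc m) = trans (cong (_+ Σ⊆ g (suc r) m) (Σ⊆≡+Σ⁺⊆ (λ r′ m′ → g r′ (suc m′)) r m))
  (+-assoc (g r (suc m)) _ _)

Σ⊆-cong : ∀ {g h} → (∀ r m → g r m ≡ h r m) → ∀ r m → Σ⊆ g r m ≡ Σ⊆ h r m
Σ⊆-cong e r zero    = e r 0
Σ⊆-cong e r (suc m) = cong₂ _+_ (Σ⊆-cong (λ r′ m′ → e r′ (suc m′)) r m) (Σ⊆-cong e (suc r) m)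

-- r + m is constant along the sum, so only pairs with the same total matter.
Σ⁺⊆-cong : ∀ {g h} r m → (∀ r′ m′ → r′ + m′ ≡ r + m → g r′ m′ ≡ h r′ m′) → Σ⁺⊆ g r m ≡ Σ⁺⊆ h r m
Σ⁺⊆-cong {g} {h} r m e = +-cancelˡ-≡ (g r m) _ _ (begin
  g r m + Σ⁺⊆ g r m  ≡⟨ Σ⊆≡+Σ⁺⊆ g r m ⟨
  Σ⊆ g r m           ≡⟨ all r m e ⟩
  Σ⊆ h r m           ≡⟨ Σ⊆≡+Σ⁺⊆ h r m ⟩
  h r m + Σ⁺⊆ h r m  ≡⟨ cong (_+ Σ⁺⊆ h r m) (e r m refl) ⟨
  g r m + Σ⁺⊆ h r m ∎)
  where
  open ≡-Reasoning
  all : ∀ {g h} r m → (∀ r′ m′ → r′ + m′ ≡ r + m → g r′ m′ ≡ h r′ m′) → Σ⊆ g r m ≡ Σ⊆ h r m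
  all r zero    e = e r 0 refl
  all r (suc m) e = cong₂ _+_
    (all r m (λ r′ m′ p → e r′ (suc m′) (trans (+-suc r′ m′) (trans (cong suc p) (sym (+-suc r m))))))
    (all (suc r) m (λ r′ m′ p → e r′ m′ (trans p (sym (+-suc r m)))))

Σ⊆-+ : ∀ g h r m → Σ⊆ (λ r′ m′ → g r′ m′ + h r′ m′) r m ≡ Σ⊆ g r m + Σ⊆ h r m
Σ⊆-+ g h r zero    = refl
Σ⊆-+ g h r (suc m) = trans
  (cong₂ _+_ (Σ⊆-+ (λ r′ m′ → g r′ (suc m′)) (λ r′ m′ → h r′ (suc m′)) r m) (Σ⊆-+ g h (suc r) m))
  (solve 4 (λ a b c d → (a :+ b) :+ (c :+ d) := (a :+ c) :+ (b :+ d)) refl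
    (Σ⊆ (λ r′ m′ → g r′ (suc m′)) r m) (Σ⊆ (λ r′ m′ → h r′ (suc m′)) r m) (Σ⊆ g (suc r) m) (Σ⊆ h (suc r) m))
  where open +-*-Solver

Σ⊆-* : ∀ c g r m → Σ⊆ (λ r′ m′ → c * g r′ m′) r m ≡ c * Σ⊆ g r m
Σ⊆-* c g r zero    = refl
Σ⊆-* c g r (suc m) = trans (cong₂ _+_ (Σ⊆-* c (λ r′ m′ → g r′ (suc m′)) r m) (Σ⊆-* c g (suc r) m))
  (sym (*-distribˡ-+ c _ _))

Σ⊆-0 : ∀ r m → Σ⊆ (λ _ _ → 0) r m ≡ 0
Σ⊆-0 r zero    = refl
Σ⊆-0 r (suc m) = cong₂ _+_ (Σ⊆-0 r m) (Σ⊆-0 (suc r) m)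

-- Removing the block of a new element from a partition of an (m + 1)-element set.
Σ⊆-S : ∀ r m k → Σ⊆ (λ _ m′ → S m′ k) r m ≡ S (suc m) (suc k)
Σ⊆-S r zero    zero    = refl
Σ⊆-S r zero    (suc k) = sym (trans (+-identityʳ _) (*-zeroʳ k))
Σ⊆-S r (suc m) zero    = trans (cong₂ _+_ (Σ⊆-0 r m) (Σ⊆-S (suc r) m 0)) (sym (trans (+-identityʳ _) (+-identityʳ _)))
Σ⊆-S r (suc m) (suc k) = begin
  Σ⊆ (λ _ m′ → suc k * S m′ (suc k) + S m′ k) r m + Σ⊆ (λ _ m′ → S m′ (suc k)) (suc r) m
    ≡⟨ cong₂ _+_ (trans (Σ⊆-+ (λ _ m′ → suc k * S m′ (suc k)) (λ _ m′ → S m′ k) r m)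
                        (cong₂ _+_ (trans (Σ⊆-* (suc k) (λ _ m′ → S m′ (suc k)) r m) (cong (suc k *_) (Σ⊆-S r m (suc k)))) (Σ⊆-S r m k)))
                 (Σ⊆-S (suc r) m (suc k)) ⟩
  suc k * S (suc m) (suc (suc k)) + S (suc m) (suc k) + S (suc m) (suc (suc k))
    ≡⟨ solve 3 (λ k a b → (con 1 :+ k) :* a :+ b :+ a := (con 2 :+ k) :* a :+ b) refl k (S (suc m) (suc (suc k))) (S (suc m) (suc k)) ⟩
  suc (suc k) * S (suc m) (suc (suc k)) + S (suc m) (suc k) ∎
  where
  open ≡-Reasoning
  open +-*-Solver

-- Combinatorially, split r + |B| into r and the choice of an element u of B. The first part is r
-- times `Σ⊆-S`. In the second, u can be chosen in m ways and the rest of B is any subset of the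
-- other m - 1 elements, so `Σ⊆-S` gives m S(m,k+1). The formal proof is an induction on m through
-- the Stirling recurrence.
Σ⊆-r*S : ∀ r m k → Σ⊆ (λ r′ m′ → r′ * S m′ k) r m ≡ r * S (suc m) (suc k) + m * S m (suc k)
Σ⊆-r*S r zero    zero    = solve 1 (λ r → r :* con 1 := r :* con 1 :+ con 0) refl r
  where open +-*-Solver
Σ⊆-r*S r zero    (suc k) = solve 2 (λ r k → r :* con 0 := r :* (k :* con 0 :+ con 0) :+ con 0) refl r k
  where open +-*-Solver
Σ⊆-r*S r (suc m) zero    = begin
  Σ⊆ (λ r′ _ → r′ * 0) r m + Σ⊆ (λ r′ m′ → r′ * S m′ 0) (suc r) m
    ≡⟨ cong₂ _+_ (trans (Σ⊆-cong (λ r′ _ → *-zeroʳ r′) r m) (Σ⊆-0 r m)) (Σ⊆-r*S (suc r) m 0) ⟩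
  suc r * (1 * S m 1 + S m 0) + m * S m 1
    ≡⟨ rearrange m ⟩
  r * S (suc (suc m)) 1 + suc m * S (suc m) 1 ∎
  where
  open ≡-Reasoning
  open +-*-Solver
  rearrange : ∀ m → suc r * (1 * S m 1 + S m 0) + m * S m 1 ≡ r * S (suc (suc m)) 1 + suc m * S (suc m) 1
  rearrange zero    = solve 1 (λ r → (con 1 :+ r) :* con 1 :+ con 0 := r :* con 1 :+ con 1) refl r
  rearrange (suc m) = solve 3 (λ r m s → (con 1 :+ r) :* (con 1 :* s :+ con 0) :+ (con 1 :+ m) :* s
                                := r :* (con 1 :* (con 1 :* s :+ con 0) :+ con 0) :+ (con 2 :+ m) :* (con 1 :* s :+ con 0)) refl
                        r m (S (suc m) 1)
Σ⊆-r*S r (suc m) (suc k) = begin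
  Σ⊆ (λ r′ m′ → r′ * (suc k * S m′ (suc k) + S m′ k)) r m + Σ⊆ (λ r′ m′ → r′ * S m′ (suc k)) (suc r) m
    ≡⟨ cong₂ _+_ (trans (Σ⊆-cong (λ r′ m′ → expand r′ (S m′ (suc k)) (S m′ k)) r m)
                 (trans (Σ⊆-+ (λ r′ m′ → suc k * (r′ * S m′ (suc k))) (λ r′ m′ → r′ * S m′ k) r m)
                        (cong₂ _+_ (trans (Σ⊆-* (suc k) (λ r′ m′ → r′ * S m′ (suc k)) r m) (cong (suc k *_) (Σ⊆-r*S r m (suc k))))
                                   (Σ⊆-r*S r m k))))
                 (Σ⊆-r*S (suc r) m (suc k)) ⟩
  suc k * (r * S (suc m) (2 + k) + m * S m (2 + k)) + (r * S (suc m) (suc k) + m * S m (suc k))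
    + (suc r * S (suc m) (2 + k) + m * S m (2 + k))
    ≡⟨ solve 6 (λ k r m a b c →
         (con 1 :+ k) :* (r :* ((con 2 :+ k) :* b :+ a) :+ m :* b) :+ (r :* c :+ m :* a)
           :+ ((con 1 :+ r) :* ((con 2 :+ k) :* b :+ a) :+ m :* b)
           := r :* ((con 2 :+ k) :* ((con 2 :+ k) :* b :+ a) :+ c) :+ (con 1 :+ m) :* ((con 2 :+ k) :* b :+ a)) refl
         k r m (S m (suc k)) (S m (2 + k)) (S (suc m) (suc k)) ⟩
  r * S (2 + m) (2 + k) + suc m * S (suc m) (2 + k) ∎
  where
  open ≡-Reasoning
  open +-*-Solver
  expand : ∀ r a b → r * (suc k * a + b) ≡ suc k * (r * a) + r * b
  expand r a b = solve 4 (λ k r a b → r :* ((con 1 :+ k) :* a :+ b) := (con 1 :+ k) :* (r :* a) :+ r :* b) refl k r a b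

Σ⁺⊆-r*S : ∀ r m k → Σ⁺⊆ (λ r′ m′ → r′ * S m′ k) r m ≡ (r * suc k + m) * S m (suc k)
Σ⁺⊆-r*S r m k = +-cancelˡ-≡ (r * S m k) _ _ (begin
  r * S m k + Σ⁺⊆ (λ r′ m′ → r′ * S m′ k) r m   ≡⟨ Σ⊆≡+Σ⁺⊆ (λ r′ m′ → r′ * S m′ k) r m ⟨
  Σ⊆ (λ r′ m′ → r′ * S m′ k) r m                ≡⟨ Σ⊆-r*S r m k ⟩
  r * (suc k * S m (suc k) + S m k) + m * S m (suc k)
    ≡⟨ solve 5 (λ r k m a b → r :* ((con 1 :+ k) :* a :+ b) :+ m :* a := r :* b :+ (r :* (con 1 :+ k) :+ m) :* a) refl
         r k m (S m (suc k)) (S m k) ⟩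
  r * S m k + (r * suc k + m) * S m (suc k) ∎)
  where
  open ≡-Reasoning
  open +-*-Solver

-- The number of enriched forests with r given roots, m further vertices and k blocks.
forests : ℕ → ℕ → ℕ → ℕ
forests zero    r m = S m 0
forests (suc k) r m = r * (S m (suc k) * rising (suc (m + r)) k)

-- For a single block only the full set B contributes, and it exists when m > 0. Otherwise r + m is
-- constant along the sum, so the rising factorial `R` comes out of it and `Σ⁺⊆-r*S` evaluates the
-- rest. In the second clause this leaves (r+1)(m+r+k+2) = r(m+r+1) + (r+1)(k+2) + m, times the
-- common factors `s` and `R`.
forests-recurrence : ∀ k r m → forests (suc k) (suc r) m ≡ forests (suc k) r m + Σ⁺⊆ (forests k) (suc r) m
forests-recurrence zero r m = begin
  suc r * (S m 1 * 1)                          ≡⟨ solve 2 (λ r s → (con 1 :+ r) :* (s :* con 1) := r :* (s :* con 1) :+ s) refl r (S m 1) ⟩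
  r * (S m 1 * 1) + S m 1                      ≡⟨ cong (r * (S m 1 * 1) +_) (nonempty m) ⟨
  r * (S m 1 * 1) + Σ⁺⊆ (λ _ m′ → S m′ 0) (suc r) m ∎
  where
  open ≡-Reasoning
  open +-*-Solver
  nonempty : ∀ m → Σ⁺⊆ (λ _ m′ → S m′ 0) (suc r) m ≡ S m 1
  nonempty m = +-cancelˡ-≡ (S m 0) _ _ (trans (sym (Σ⊆≡+Σ⁺⊆ (λ _ m′ → S m′ 0) (suc r) m))
    (trans (Σ⊆-S (suc r) m 0) (solve 2 (λ a b → con 1 :* a :+ b := b :+ a) refl (S m 1) (S m 0))))
forests-recurrence (suc k) r m = begin
  suc r * (s * (rising (suc (m + suc r)) k * (suc (m + suc r) + k)))
    ≡⟨ cong (λ M → suc r * (s * (rising (suc M) k * (suc M + k)))) (+-suc m r) ⟩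
  suc r * (s * (R * (suc (suc (m + r)) + k)))
    ≡⟨ solve 5 (λ r m k s R →
         (con 1 :+ r) :* (s :* (R :* (con 2 :+ (m :+ r) :+ k)))
           := r :* (s :* ((con 1 :+ (m :+ r)) :* R)) :+ ((con 1 :+ r) :* (con 2 :+ k) :+ m) :* s :* R) refl r m k s R ⟩
  r * (s * (suc (m + r) * R)) + (suc r * suc (suc k) + m) * s * R
    ≡⟨ cong₂ _+_ (cong (λ z → r * (s * z)) (sym (rising-suc (suc (m + r)) k))) (sym blockSum) ⟩
  r * (s * rising (suc (m + r)) (suc k)) + Σ⁺⊆ (forests (suc k)) (suc r) m ∎
  where
  open ≡-Reasoning
  open +-*-Solver
  s = S m (suc (suc k))
  R = rising (suc (suc (m + r))) k
  pull : ∀ c g r m → Σ⁺⊆ (λ r′ m′ → c * g r′ m′) r m ≡ c * Σ⁺⊆ g r m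
  pull c g r m = +-cancelˡ-≡ (c * g r m) _ _ (trans (sym (Σ⊆≡+Σ⁺⊆ (λ r′ m′ → c * g r′ m′) r m))
    (trans (Σ⊆-* c g r m) (trans (cong (c *_) (Σ⊆≡+Σ⁺⊆ g r m)) (*-distribˡ-+ c _ _))))
  blockSum : Σ⁺⊆ (forests (suc k)) (suc r) m ≡ (suc r * suc (suc k) + m) * s * R
  blockSum = begin
    Σ⁺⊆ (forests (suc k)) (suc r) m
      ≡⟨ Σ⁺⊆-cong (suc r) m (λ r′ m′ p → trans
           (cong (λ M → r′ * (S m′ (suc k) * rising (suc M) k)) (trans (+-comm m′ r′) (trans p (cong suc (+-comm r m)))))
           (solve 3 (λ r s R → r :* (s :* R) := R :* (r :* s)) refl r′ (S m′ (suc k)) R)) ⟩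
    Σ⁺⊆ (λ r′ m′ → R * (r′ * S m′ (suc k))) (suc r) m
      ≡⟨ pull R (λ r′ m′ → r′ * S m′ (suc k)) (suc r) m ⟩
    R * Σ⁺⊆ (λ r′ m′ → r′ * S m′ (suc k)) (suc r) m
      ≡⟨ cong (R *_) (Σ⁺⊆-r*S (suc r) m (suc k)) ⟩
    R * ((suc r * suc (suc k) + m) * s)
      ≡⟨ *-comm R _ ⟩
    (suc r * suc (suc k) + m) * s * R ∎

-- Forests as partly consumed trees

private variable
  n : ℕ

data Status : Set where
  finished pending unplaced : Status

unplaced? : ∀ s → Dec (s ≡ unplaced)
unplaced? finished = no λ ()
unplaced? pending  = no λ ()
unplaced? unplaced = yes refl

State : ℕ → Set
State = Vec Status

finish : Fin n → State n → State n
finish v st = st [ v ]≔ finished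

activateIf : Bool → Status → Status
activateIf inside unplaced = pending
activateIf _      s        = s

activate : Subset n → State n → State n
activate = Vec.zipWith activateIf

-- A finite ascent along parents to a pending vertex. Being inductive, it excludes cycles among the
-- vertices for which it is required.
data Reach {n} (st : State n) (T : ParentMap n) (u : Fin n) : Set where
  root : lookup st u ≡ pending → Reach st T u
  step : ∀ {p} → lookup T u ≡ just p → Reach st T p → Reach st T u

-- A partly consumed enriched forest: its roots are the pending vertices, its other vertices the
-- unplaced ones, and finished vertices do not take part in it.
record Valid {n} (st : State n) (t : TreeData n) : Set where
  field
    nonempty : ∀ v → All Nonempty (lookup (blocks t) v)
    disjoint : ∀ v → AllPairs (λ b c → Empty (b ∩ c)) (lookup (blocks t) v)
    covered  : ∀ {u v} → Any (u ∈ˢ_) (lookup (blocks t) v) → lookup (parent t) u ≡ just v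
    covers   : ∀ {u v} → lookup (parent t) u ≡ just v → Any (u ∈ˢ_) (lookup (blocks t) v)
    orphan   : ∀ {u} → lookup st u ≢ unplaced → lookup (parent t) u ≡ nothing
    reach    : ∀ {u} → lookup st u ≡ unplaced → Reach st (parent t) u

open Valid

nothing≢just : ∀ {A : Set} {x : A} {m : Maybe A} → m ≡ nothing → m ≢ just x
nothing≢just refl ()

pending≢unplaced : ∀ {s} → s ≡ pending → s ≢ unplaced
pending≢unplaced refl ()

finished≢unplaced : ∀ {s} → s ≡ finished → s ≢ unplaced
finished≢unplaced refl ()

finished≢pending : ∀ {s} → s ≡ finished → s ≢ pending
finished≢pending refl ()

child-unplaced : ∀ {st : State n} {t u v} → Valid st t → lookup (parent t) u ≡ just v → lookup st u ≡ unplaced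
child-unplaced {st = st} {u = u} V e with unplaced? (lookup st u)
... | yes p = p
... | no ¬p = ⊥-elim (nothing≢just (orphan V ¬p) e)

finished-unreachable : ∀ {st : State n} {t v} → Valid st t → lookup st v ≡ finished → ¬ Reach st (parent t) v
finished-unreachable V f (root p)   = finished≢pending f p
finished-unreachable V f (step e _) = nothing≢just (orphan V (finished≢unplaced f)) e

-- A child of v is unplaced, so its ascent to a pending vertex would pass through v, which is
-- neither pending nor has a parent.
finished-childless : ∀ {st : State n} {t u v} → Valid st t → lookup st v ≡ finished → lookup (parent t) u ≢ just v
finished-childless {st = st} {t} {u} {v} V f e with reach V (child-unplaced V e)
... | root p    = pending≢unplaced p (child-unplaced V e)
... | step e′ r = finished-unreachable V f (subst (Reach st (parent t)) (just-injective (trans (sym e′) e)) r)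

-- A block is nonempty and would contain a child. This keeps the forests in which v is discarded
-- apart from those in which v has a block.
finished-blockless : ∀ {st : State n} {t v} → Valid st t → lookup st v ≡ finished → lookup (blocks t) v ≡ []
finished-blockless {t = t} {v} V f with lookup (blocks t) v in eq
... | []     = refl
... | b ∷ bs with subst (All Nonempty) eq (nonempty V v)
...   | (u , u∈b) ∷ _ = ⊥-elim (finished-childless V f (covered V (subst (Any (u ∈ˢ_)) (sym eq) (here u∈b))))

module _ {st : State n} {v : Fin n} (v-pending : lookup st v ≡ pending) where

  private
    finish-v : lookup (finish v st) v ≡ finished
    finish-v = lookup∘updateAt v st
    finish-≢ : ∀ {u} → u ≢ v → lookup (finish v st) u ≡ lookup st u
    finish-≢ {u} u≢v = lookup∘updateAt′ u v u≢v st
    unplaced⇒≢ : ∀ {u} → lookup st u ≡ unplaced → u ≢ v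
    unplaced⇒≢ p refl = pending≢unplaced v-pending p

  finish-sound : ∀ {t} → Valid (finish v st) t → Valid st t
  finish-sound {t} V = record
    { nonempty = nonempty V ; disjoint = disjoint V ; covered = covered V ; covers = covers V
    ; orphan = λ ¬p → orphan V (λ p → ¬p (trans (sym (finish-≢ (≢v p))) p))
    ; reach = λ p → weaken (reach V (trans (finish-≢ (unplaced⇒≢ p)) p))
    }
    where
    ≢v : ∀ {u} → lookup (finish v st) u ≡ unplaced → u ≢ v
    ≢v p refl = finished≢unplaced finish-v p
    weaken : ∀ {u} → Reach (finish v st) (parent t) u → Reach st (parent t) u
    weaken {u} (root p) with u ≟ᶠ v
    ... | yes refl = root v-pending
    ... | no u≢v   = root (trans (sym (finish-≢ u≢v)) p)
    weaken (step e r) = step e (weaken r)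

  finish-complete : ∀ {t} → Valid st t → lookup (blocks t) v ≡ [] → Valid (finish v st) t
  finish-complete {t} V bv≡[] = record
    { nonempty = nonempty V ; disjoint = disjoint V ; covered = covered V ; covers = covers V
    ; orphan = λ {u} ¬p → orphan V (λ p → ¬p (trans (finish-≢ (unplaced⇒≢ p)) p))
    ; reach = λ {u} p → strengthen (reach V (trans (sym (finish-≢ (≢v p))) p)) (≢v p)
    }
    where
    ≢v : ∀ {u} → lookup (finish v st) u ≡ unplaced → u ≢ v
    ≢v p refl = finished≢unplaced finish-v p
    parent≢v : ∀ {u p} → lookup (parent t) u ≡ just p → p ≢ v
    parent≢v e refl with subst (Any _) bv≡[] (covers V e)
    ... | ()
    -- An ascent starting elsewhere never arrives at v: without blocks, v has no child.
    strengthen : ∀ {u} → Reach st (parent t) u → u ≢ v → Reach (finish v st) (parent t) u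
    strengthen (root p)   u≢v = root (trans (finish-≢ u≢v) p)
    strengthen (step e r) u≢v = step e (strengthen r (parent≢v e))

-- Attaching and detaching a first block

lookup-ext : ∀ {A : Set} {m} {xs ys : Vec A m} → (∀ i → lookup xs i ≡ lookup ys i) → xs ≡ ys
lookup-ext {xs = xs} {ys} e = trans (sym (tabulate∘lookup xs)) (trans (tabulate-cong e) (tabulate∘lookup ys))

updateParents : Subset n → Maybe (Fin n) → ParentMap n → ParentMap n
updateParents B m T = tabulate λ u → if lookup B u then m else lookup T u

-- `push v B` undoes `pop v B` on valid forests whose first block at v is B; see `push-pop`.
push pop : Fin n → Subset n → TreeData n → TreeData n
push v B t = treeData (updateParents B (just v) (parent t)) (blocks t [ v ]%= (B ∷_))
pop  v B t = treeData (updateParents B nothing (parent t)) (blocks t [ v ]%= List.drop 1)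

updateParents-∈ : ∀ {B : Subset n} {m} T {u} → u ∈ˢ B → lookup (updateParents B m T) u ≡ m
updateParents-∈ {B = B} {m} T {u} u∈B =
  trans (lookup∘tabulate _ u) (cong (if_then m else lookup T u) ([]=⇒lookup u∈B))

∉⇒outside : ∀ {B : Subset n} {u} → u ∉ˢ B → lookup B u ≡ outside
∉⇒outside {B = B} {u} u∉B with lookup B u in eq
... | true  = ⊥-elim (u∉B (lookup⇒[]= u B eq))
... | false = refl

updateParents-∉ : ∀ {B : Subset n} {m} T {u} → u ∉ˢ B → lookup (updateParents B m T) u ≡ lookup T u
updateParents-∉ {B = B} {m} T {u} u∉B =
  trans (lookup∘tabulate _ u) (cong (if_then m else lookup T u) (∉⇒outside u∉B))

activateIf-outside : ∀ s → activateIf outside s ≡ s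
activateIf-outside finished = refl
activateIf-outside pending  = refl
activateIf-outside unplaced = refl

activate-∉ : ∀ {B : Subset n} {st : State n} {u} → u ∉ˢ B → lookup (activate B st) u ≡ lookup st u
activate-∉ {B = B} {st} {u} u∉B = trans (lookup-zipWith activateIf u B st)
  (trans (cong (λ b → activateIf b (lookup st u)) (∉⇒outside u∉B)) (activateIf-outside (lookup st u)))

activate-∈ : ∀ {B : Subset n} {st : State n} {u} → u ∈ˢ B → lookup st u ≡ unplaced → lookup (activate B st) u ≡ pending
activate-∈ {B = B} {st} {u} u∈B p = trans (lookup-zipWith activateIf u B st) (cong₂ activateIf ([]=⇒lookup u∈B) p)

activate-pending : ∀ {B : Subset n} {st : State n} {u} → lookup st u ≡ pending → lookup (activate B st) u ≡ pending
activate-pending {B = B} {st} {u} p = trans (lookup-zipWith activateIf u B st) (trans (cong (activateIf (lookup B u)) p) (keep (lookup B u)))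
  where
  keep : ∀ b → activateIf b pending ≡ pending
  keep true  = refl
  keep false = refl

Admissible : State n → Subset n → Set
Admissible st B = Nonempty B × (∀ {u} → u ∈ˢ B → lookup st u ≡ unplaced)

module _ {st : State n} {v : Fin n} (v-pending : lookup st v ≡ pending) {B : Subset n} where

  -- In `activate B st` the vertices of B are pending, hence without parent in `t`. Giving them the
  -- parent v therefore overwrites no edge, and B is disjoint from the blocks already at v, whose
  -- members do have a parent.
  push-sound : ∀ {t} → Admissible st B → Valid (activate B st) t → Valid st (push v B t)
  push-sound {t} (B≢∅ , B-unplaced) V = record
    { nonempty = nonempty′ ; disjoint = disjoint′ ; covered = covered′ _ _ ; covers = covers′ _ _
    ; orphan = orphan′ ; reach = reach′ }
    where
    T = parent t
    β = blocks t
    T′ = parent (push v B t)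
    β′ = blocks (push v B t)
    β′-v : lookup β′ v ≡ B ∷ lookup β v
    β′-v = lookup∘updateAt v β
    β′-≢ : ∀ {w} → w ≢ v → lookup β′ w ≡ lookup β w
    β′-≢ {w} w≢v = lookup∘updateAt′ w v w≢v β
    T-B : ∀ {u} → u ∈ˢ B → lookup T u ≡ nothing
    T-B u∈B = orphan V (pending≢unplaced (activate-∈ u∈B (B-unplaced u∈B)))
    keep : ∀ {u w} → lookup T u ≡ just w → lookup T′ u ≡ just w
    keep {u} e = trans (updateParents-∉ T (λ u∈B → nothing≢just (T-B u∈B) e)) e
    nonempty′ : ∀ w → All Nonempty (lookup β′ w)
    nonempty′ w with w ≟ᶠ v
    ... | yes refl = subst (All Nonempty) (sym β′-v) (B≢∅ ∷ nonempty V v)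
    ... | no w≢v   = subst (All Nonempty) (sym (β′-≢ w≢v)) (nonempty V w)
    B-disjoint : ∀ {bs} → (∀ {u} → Any (u ∈ˢ_) bs → lookup T u ≡ just v) → All (λ c → Empty (B ∩ c)) bs
    B-disjoint {[]}     cov = []
    B-disjoint {c ∷ bs} cov =
      (λ (u , u∈) → let (u∈B , u∈c) = x∈p∩q⁻ B c u∈ in nothing≢just (T-B u∈B) (cov (here u∈c)))
      ∷ B-disjoint (λ u∈bs → cov (there u∈bs))
    disjoint′ : ∀ w → AllPairs (λ b c → Empty (b ∩ c)) (lookup β′ w)
    disjoint′ w with w ≟ᶠ v
    ... | yes refl = subst (AllPairs _) (sym β′-v) (B-disjoint (covered V) ∷ disjoint V v)
    ... | no w≢v   = subst (AllPairs _) (sym (β′-≢ w≢v)) (disjoint V w)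
    covered′ : ∀ u w → Any (u ∈ˢ_) (lookup β′ w) → lookup T′ u ≡ just w
    covered′ u w a with w ≟ᶠ v
    ... | no w≢v = keep (covered V (subst (Any (u ∈ˢ_)) (β′-≢ w≢v) a))
    ... | yes refl with subst (Any (u ∈ˢ_)) β′-v a
    ...   | here u∈B = updateParents-∈ T u∈B
    ...   | there a′ = keep (covered V a′)
    covers′ : ∀ u w → lookup T′ u ≡ just w → Any (u ∈ˢ_) (lookup β′ w)
    covers′ u w e with u ∈ˢ? B
    ... | yes u∈B with just-injective (trans (sym (updateParents-∈ T u∈B)) e)
    ...   | refl = subst (Any (u ∈ˢ_)) (sym β′-v) (here u∈B)
    covers′ u w e | no u∉B with w ≟ᶠ v
    ...   | yes refl = subst (Any (u ∈ˢ_)) (sym β′-v) (there (covers V (trans (sym (updateParents-∉ T u∉B)) e)))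
    ...   | no w≢v   = subst (Any (u ∈ˢ_)) (sym (β′-≢ w≢v)) (covers V (trans (sym (updateParents-∉ T u∉B)) e))
    orphan′ : ∀ {u} → lookup st u ≢ unplaced → lookup T′ u ≡ nothing
    orphan′ {u} ¬p = trans (updateParents-∉ T u∉B) (orphan V (λ p → ¬p (trans (sym (activate-∉ u∉B)) p)))
      where
      u∉B : u ∉ˢ B
      u∉B u∈B = ¬p (B-unplaced u∈B)
    reach-B : ∀ {u} → u ∈ˢ B → Reach st T′ u
    reach-B u∈B = step (updateParents-∈ T u∈B) (root v-pending)
    -- An ascent may end in B, whose vertices are no longer pending in `st`; the new edge to v
    -- prolongs it by one step.
    transfer : ∀ {u} → Reach (activate B st) T u → Reach st T′ u
    transfer {u} (root p) with u ∈ˢ? B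
    ... | yes u∈B = reach-B u∈B
    ... | no u∉B  = root (trans (sym (activate-∉ u∉B)) p)
    transfer (step e r) = step (keep e) (transfer r)
    reach′ : ∀ {u} → lookup st u ≡ unplaced → Reach st T′ u
    reach′ {u} p with u ∈ˢ? B
    ... | yes u∈B = reach-B u∈B
    ... | no u∉B  = transfer (reach V (trans (activate-∉ u∉B) p))

  module _ {t : TreeData n} {bs : List (Subset n)} (V : Valid st t) (β-v : lookup (blocks t) v ≡ B ∷ bs) where

    private
      T = parent t
      β = blocks t
      T′ = parent (pop v B t)
      β′ = blocks (pop v B t)
      T-B : ∀ {u} → u ∈ˢ B → lookup T u ≡ just v
      T-B u∈B = covered V (subst (Any _) (sym β-v) (here u∈B))
      β′-v : lookup β′ v ≡ bs
      β′-v = trans (lookup∘updateAt v β) (cong (List.drop 1) β-v)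
      β′-≢ : ∀ {w} → w ≢ v → lookup β′ w ≡ lookup β w
      β′-≢ {w} w≢v = lookup∘updateAt′ w v w≢v β
      B-disjoint : ∀ {u} → u ∈ˢ B → ¬ Any (u ∈ˢ_) bs
      B-disjoint {u} u∈B = go (AllPairs.head (subst (AllPairs _) β-v (disjoint V v)))
        where
        go : ∀ {cs} → All (λ c → Empty (B ∩ c)) cs → ¬ Any (u ∈ˢ_) cs
        go (e ∷ _)  (here u∈c) = e (u , x∈p∩q⁺ (u∈B , u∈c))
        go (_ ∷ es) (there a)  = go es a
      widen : ∀ {u w} → Any (u ∈ˢ_) (lookup β′ w) → Any (u ∈ˢ_) (lookup β w)
      widen {u} {w} a with w ≟ᶠ v
      ... | yes refl = subst (Any (u ∈ˢ_)) (sym β-v) (there (subst (Any (u ∈ˢ_)) β′-v a))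
      ... | no w≢v   = subst (Any (u ∈ˢ_)) (β′-≢ w≢v) a

    first-admissible : Admissible st B
    first-admissible = All.head (subst (All Nonempty) β-v (nonempty V v)) , λ u∈B → child-unplaced V (T-B u∈B)

    -- A vertex of a remaining block lies outside B: otherwise its parent is v, and the blocks of v
    -- are disjoint. So its parent is unchanged. An ascent that meets B may now stop there, since
    -- the vertices of B have become pending.
    pop-complete : Valid (activate B st) (pop v B t)
    pop-complete = record
      { nonempty = nonempty′ ; disjoint = disjoint′ ; covered = covered′ _ _ ; covers = covers′ _ _
      ; orphan = orphan′ ; reach = λ {u} p → transfer (reach V (back p)) }
      where
      B-unplaced = proj₂ first-admissible
      nonempty′ : ∀ w → All Nonempty (lookup β′ w)
      nonempty′ w with w ≟ᶠ v
      ... | yes refl = subst (All Nonempty) (sym β′-v) (All.tail (subst (All Nonempty) β-v (nonempty V v)))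
      ... | no w≢v   = subst (All Nonempty) (sym (β′-≢ w≢v)) (nonempty V w)
      disjoint′ : ∀ w → AllPairs (λ b c → Empty (b ∩ c)) (lookup β′ w)
      disjoint′ w with w ≟ᶠ v
      ... | yes refl = subst (AllPairs _) (sym β′-v) (AllPairs.tail (subst (AllPairs _) β-v (disjoint V v)))
      ... | no w≢v   = subst (AllPairs _) (sym (β′-≢ w≢v)) (disjoint V w)
      covered′ : ∀ u w → Any (u ∈ˢ_) (lookup β′ w) → lookup T′ u ≡ just w
      covered′ u w a = trans (updateParents-∉ T u∉B) (covered V (widen a))
        where
        u∉B : u ∉ˢ B
        u∉B u∈B with just-injective (trans (sym (T-B u∈B)) (covered V (widen a)))
        ... | refl = B-disjoint u∈B (subst (Any (u ∈ˢ_)) β′-v a)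
      covers′ : ∀ u w → lookup T′ u ≡ just w → Any (u ∈ˢ_) (lookup β′ w)
      covers′ u w e with u ∈ˢ? B
      ... | yes u∈B = ⊥-elim (nothing≢just (updateParents-∈ T u∈B) e)
      ... | no u∉B with w ≟ᶠ v
      ...   | no w≢v = subst (Any (u ∈ˢ_)) (sym (β′-≢ w≢v)) (covers V (trans (sym (updateParents-∉ T u∉B)) e))
      ...   | yes refl with subst (Any (u ∈ˢ_)) β-v (covers V (trans (sym (updateParents-∉ T u∉B)) e))
      ...     | here u∈B = ⊥-elim (u∉B u∈B)
      ...     | there a  = subst (Any (u ∈ˢ_)) (sym β′-v) a
      orphan′ : ∀ {u} → lookup (activate B st) u ≢ unplaced → lookup T′ u ≡ nothing
      orphan′ {u} ¬p with u ∈ˢ? B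
      ... | yes u∈B = updateParents-∈ T u∈B
      ... | no u∉B  = trans (updateParents-∉ T u∉B) (orphan V (λ p → ¬p (trans (activate-∉ u∉B) p)))
      back : ∀ {u} → lookup (activate B st) u ≡ unplaced → lookup st u ≡ unplaced
      back {u} p with u ∈ˢ? B
      ... | yes u∈B = B-unplaced u∈B
      ... | no u∉B  = trans (sym (activate-∉ u∉B)) p
      transfer : ∀ {u} → Reach st T u → Reach (activate B st) T′ u
      transfer (root p) = root (activate-pending {B = B} {st} p)
      transfer {u} (step e r) with u ∈ˢ? B
      ... | yes u∈B = root (activate-∈ u∈B (B-unplaced u∈B))
      ... | no u∉B  = step (trans (updateParents-∉ T u∉B) e) (transfer r)

    push-pop : push v B (pop v B t) ≡ t
    push-pop = cong₂ treeData
      (trans (tabulate-cong parents) (tabulate∘lookup T))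
      (lookup-ext λ w → blocks-at w)
      where
      parents : ∀ u → (if lookup B u then just v else lookup T′ u) ≡ lookup T u
      parents u with lookup B u in eq
      ... | true  = sym (T-B (lookup⇒[]= u B eq))
      ... | false = updateParents-∉ T u∉B
        where
        u∉B : u ∉ˢ B
        u∉B u∈B with trans (sym ([]=⇒lookup u∈B)) eq
        ... | ()
      blocks-at : ∀ w → lookup (blocks (push v B (pop v B t))) w ≡ lookup β w
      blocks-at w with w ≟ᶠ v
      ... | yes refl = trans (lookup∘updateAt v β′) (trans (cong (B ∷_) β′-v) (sym β-v))
      ... | no w≢v   = trans (lookup∘updateAt′ w v w≢v β′) (β′-≢ w≢v)

-- Enumeration of forests

#pending #unplaced : State n → ℕ
#pending []              = 0
#pending (finished ∷ st) = #pending st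
#pending (pending  ∷ st) = suc (#pending st)
#pending (unplaced ∷ st) = #pending st
#unplaced []              = 0
#unplaced (finished ∷ st) = #unplaced st
#unplaced (pending  ∷ st) = #unplaced st
#unplaced (unplaced ∷ st) = suc (#unplaced st)

-- The recursion copies that of `Σ⊆` and `Σ⁺⊆`, with vertices that are not unplaced skipped; sums
-- over these lists then reduce to `Σ⊆` and `Σ⁺⊆` by induction on the state.
subsets nonemptySubsets : State n → List (Subset n)
subsets []              = [] ∷ []
subsets (finished ∷ st) = map (outside ∷_) (subsets st)
subsets (pending  ∷ st) = map (outside ∷_) (subsets st)
subsets (unplaced ∷ st) = map (outside ∷_) (subsets st) ++ map (inside ∷_) (subsets st)
nonemptySubsets []              = []
nonemptySubsets (finished ∷ st) = map (outside ∷_) (nonemptySubsets st)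
nonemptySubsets (pending  ∷ st) = map (outside ∷_) (nonemptySubsets st)
nonemptySubsets (unplaced ∷ st) = map (outside ∷_) (nonemptySubsets st) ++ map (inside ∷_) (subsets st)

private
  disjoint-maps : ∀ {xs ys : List (Subset n)} {B} → ¬ (B ∈ map (outside ∷_) xs × B ∈ map (inside ∷_) ys)
  disjoint-maps (p , q) with ∈-map⁻ (outside ∷_) p | ∈-map⁻ (inside ∷_) q
  ... | _ , _ , refl | _ , _ , ()

subsets-unique : (st : State n) → Unique (subsets st)
subsets-unique []              = [] ∷ []
subsets-unique (finished ∷ st) = Uniqueₚ.map⁺ ∷ᵛ-injectiveʳ (subsets-unique st)
subsets-unique (pending  ∷ st) = Uniqueₚ.map⁺ ∷ᵛ-injectiveʳ (subsets-unique st)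
subsets-unique (unplaced ∷ st) = Uniqueₚ.++⁺ (Uniqueₚ.map⁺ ∷ᵛ-injectiveʳ (subsets-unique st))
  (Uniqueₚ.map⁺ ∷ᵛ-injectiveʳ (subsets-unique st)) disjoint-maps

nonemptySubsets-unique : (st : State n) → Unique (nonemptySubsets st)
nonemptySubsets-unique []              = []
nonemptySubsets-unique (finished ∷ st) = Uniqueₚ.map⁺ ∷ᵛ-injectiveʳ (nonemptySubsets-unique st)
nonemptySubsets-unique (pending  ∷ st) = Uniqueₚ.map⁺ ∷ᵛ-injectiveʳ (nonemptySubsets-unique st)
nonemptySubsets-unique (unplaced ∷ st) = Uniqueₚ.++⁺ (Uniqueₚ.map⁺ ∷ᵛ-injectiveʳ (nonemptySubsets-unique st))
  (Uniqueₚ.map⁺ ∷ᵛ-injectiveʳ (subsets-unique st)) disjoint-maps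

Unplaced : State n → Subset n → Set
Unplaced st B = ∀ {u} → u ∈ˢ B → lookup st u ≡ unplaced

Unplaced-outside : ∀ {s} {st : State n} {B} → Unplaced st B → Unplaced (s ∷ st) (outside ∷ B)
Unplaced-outside U (there u∈B) = U u∈B

Unplaced-inside : ∀ {st : State n} {B} → Unplaced st B → Unplaced (unplaced ∷ st) (inside ∷ B)
Unplaced-inside U here        = refl
Unplaced-inside U (there u∈B) = U u∈B

Nonempty-there : ∀ {s} {B : Subset n} → Nonempty B → Nonempty (s ∷ B)
Nonempty-there (u , u∈B) = Fin.suc u , there u∈B

subsets-sound : (st : State n) → ∀ {B} → B ∈ subsets st → Unplaced st B
subsets-sound [] (here refl) ()
subsets-sound (finished ∷ st) B∈ with ∈-map⁻ (outside ∷_) B∈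
... | _ , B∈′ , refl = Unplaced-outside (subsets-sound st B∈′)
subsets-sound (pending ∷ st) B∈ with ∈-map⁻ (outside ∷_) B∈
... | _ , B∈′ , refl = Unplaced-outside (subsets-sound st B∈′)
subsets-sound (unplaced ∷ st) B∈ with ∈-++⁻ (map (outside ∷_) (subsets st)) B∈
... | inj₁ p with ∈-map⁻ (outside ∷_) p
...   | _ , B∈′ , refl = Unplaced-outside (subsets-sound st B∈′)
subsets-sound (unplaced ∷ st) B∈ | inj₂ p with ∈-map⁻ (inside ∷_) p
...   | _ , B∈′ , refl = Unplaced-inside (subsets-sound st B∈′)

nonemptySubsets-sound : (st : State n) → ∀ {B} → B ∈ nonemptySubsets st → Admissible st B
nonemptySubsets-sound (finished ∷ st) B∈ with ∈-map⁻ (outside ∷_) B∈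
... | _ , B∈′ , refl with nonemptySubsets-sound st B∈′
...   | N , U = Nonempty-there N , Unplaced-outside U
nonemptySubsets-sound (pending ∷ st) B∈ with ∈-map⁻ (outside ∷_) B∈
... | _ , B∈′ , refl with nonemptySubsets-sound st B∈′
...   | N , U = Nonempty-there N , Unplaced-outside U
nonemptySubsets-sound (unplaced ∷ st) B∈ with ∈-++⁻ (map (outside ∷_) (nonemptySubsets st)) B∈
... | inj₂ p with ∈-map⁻ (inside ∷_) p
...   | _ , B∈′ , refl = (Fin.zero , here) , Unplaced-inside (subsets-sound st B∈′)
nonemptySubsets-sound (unplaced ∷ st) B∈ | inj₁ p with ∈-map⁻ (outside ∷_) p
... | _ , B∈′ , refl with nonemptySubsets-sound st B∈′
...   | N , U = Nonempty-there N , Unplaced-outside U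

subsets-complete : (st : State n) → ∀ {B} → Unplaced st B → B ∈ subsets st
subsets-complete []              {[]}          U = here refl
subsets-complete (finished ∷ st) {inside ∷ B}  U with U here
... | ()
subsets-complete (finished ∷ st) {outside ∷ B} U = ∈-map⁺ (outside ∷_) (subsets-complete st (U ∘ there))
subsets-complete (pending ∷ st)  {inside ∷ B}  U with U here
... | ()
subsets-complete (pending ∷ st)  {outside ∷ B} U = ∈-map⁺ (outside ∷_) (subsets-complete st (U ∘ there))
subsets-complete (unplaced ∷ st) {outside ∷ B} U =
  ∈-++⁺ˡ (∈-map⁺ (outside ∷_) (subsets-complete st (U ∘ there)))
subsets-complete (unplaced ∷ st) {inside ∷ B}  U =
  ∈-++⁺ʳ (map (outside ∷_) (subsets st)) (∈-map⁺ (inside ∷_) (subsets-complete st (U ∘ there)))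

private
  Admissible-tail : ∀ {s} {st : State n} {B} → Admissible (s ∷ st) (outside ∷ B) → Admissible st B
  Admissible-tail ((Fin.suc u , there u∈B) , U) = (u , u∈B) , U ∘ there

nonemptySubsets-complete : (st : State n) → ∀ {B} → Admissible st B → B ∈ nonemptySubsets st
nonemptySubsets-complete []              ((() , _) , _)
nonemptySubsets-complete (finished ∷ st) {inside ∷ B}  (_ , U) with U here
... | ()
nonemptySubsets-complete (finished ∷ st) {outside ∷ B} A = ∈-map⁺ (outside ∷_) (nonemptySubsets-complete st (Admissible-tail A))
nonemptySubsets-complete (pending ∷ st)  {inside ∷ B}  (_ , U) with U here
... | ()
nonemptySubsets-complete (pending ∷ st)  {outside ∷ B} A = ∈-map⁺ (outside ∷_) (nonemptySubsets-complete st (Admissible-tail A))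
nonemptySubsets-complete (unplaced ∷ st) {outside ∷ B} A =
  ∈-++⁺ˡ (∈-map⁺ (outside ∷_) (nonemptySubsets-complete st (Admissible-tail A)))
nonemptySubsets-complete (unplaced ∷ st) {inside ∷ B}  (_ , U) =
  ∈-++⁺ʳ (map (outside ∷_) (nonemptySubsets st)) (∈-map⁺ (inside ∷_) (subsets-complete st (U ∘ there)))

-- Sums over subsets and counts by number of blocks

sumOver : ∀ {A : Set} → (A → ℕ) → List A → ℕ
sumOver f xs = sum (map f xs)

sumOver-++ : ∀ {A : Set} (f : A → ℕ) xs ys → sumOver f (xs ++ ys) ≡ sumOver f xs + sumOver f ys
sumOver-++ f xs ys = trans (cong sum (map-++ f xs ys)) (sum-++ (map f xs) (map f ys))

sumOver-map : ∀ {A B : Set} (f : B → ℕ) (g : A → B) xs → sumOver f (map g xs) ≡ sumOver (f ∘ g) xs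
sumOver-map f g xs = cong sum (sym (map-∘ xs))

-- Accounts for a pending vertex at the head of the state, which adds one to the number of roots in
-- all summands at once.
Σ⊆-suc : ∀ g r m → Σ⊆ (g ∘ suc) r m ≡ Σ⊆ g (suc r) m
Σ⊆-suc g r zero    = refl
Σ⊆-suc g r (suc m) = cong₂ _+_ (Σ⊆-suc (λ r′ m′ → g r′ (suc m′)) r m) (Σ⊆-suc g (suc r) m)

Σ⁺⊆-suc : ∀ g r m → Σ⁺⊆ (g ∘ suc) r m ≡ Σ⁺⊆ g (suc r) m
Σ⁺⊆-suc g r zero    = refl
Σ⁺⊆-suc g r (suc m) = cong₂ _+_ (Σ⁺⊆-suc (λ r′ m′ → g r′ (suc m′)) r m) (Σ⊆-suc g (suc r) m)

afterActivation : (ℕ → ℕ → ℕ) → State n → Subset n → ℕ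
afterActivation g st B = g (#pending (activate B st)) (#unplaced (activate B st))

sum-subsets : ∀ g (st : State n) → sumOver (afterActivation g st) (subsets st) ≡ Σ⊆ g (#pending st) (#unplaced st)
sum-subsets g []              = ℕₚ.+-identityʳ (g 0 0)
sum-subsets g (finished ∷ st) = trans (sumOver-map _ (outside ∷_) (subsets st)) (sum-subsets g st)
sum-subsets g (pending  ∷ st) = trans (sumOver-map _ (outside ∷_) (subsets st))
  (trans (sum-subsets (g ∘ suc) st) (Σ⊆-suc g (#pending st) (#unplaced st)))
sum-subsets g (unplaced ∷ st) = trans (sumOver-++ _ (map (outside ∷_) (subsets st)) _) (cong₂ _+_
  (trans (sumOver-map _ (outside ∷_) (subsets st)) (sum-subsets (λ r m → g r (suc m)) st))
  (trans (sumOver-map _ (inside ∷_) (subsets st)) (trans (sum-subsets (g ∘ suc) st) (Σ⊆-suc g (#pending st) (#unplaced st)))))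

sum-nonemptySubsets : ∀ g (st : State n) → sumOver (afterActivation g st) (nonemptySubsets st) ≡ Σ⁺⊆ g (#pending st) (#unplaced st)
sum-nonemptySubsets g []              = refl
sum-nonemptySubsets g (finished ∷ st) = trans (sumOver-map _ (outside ∷_) (nonemptySubsets st)) (sum-nonemptySubsets g st)
sum-nonemptySubsets g (pending  ∷ st) = trans (sumOver-map _ (outside ∷_) (nonemptySubsets st))
  (trans (sum-nonemptySubsets (g ∘ suc) st) (Σ⁺⊆-suc g (#pending st) (#unplaced st)))
sum-nonemptySubsets g (unplaced ∷ st) = trans (sumOver-++ _ (map (outside ∷_) (nonemptySubsets st)) _) (cong₂ _+_
  (trans (sumOver-map _ (outside ∷_) (nonemptySubsets st)) (sum-nonemptySubsets (λ r m → g r (suc m)) st))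
  (trans (sumOver-map _ (inside ∷_) (subsets st)) (trans (sum-subsets (g ∘ suc) st) (Σ⊆-suc g (#pending st) (#unplaced st)))))

-- Kronecker's delta. Counting by a sum of deltas, rather than by a filter, matches the coefficients
-- of the weights in `coeff-X^`.
δ : ℕ → ℕ → ℕ
δ zero    zero    = 1
δ zero    (suc j) = 0
δ (suc k) zero    = 0
δ (suc k) (suc j) = δ k j

count : ℕ → List (TreeData n) → ℕ
count k = sumOver (δ k ∘ blockCount)

blockCount-push : ∀ v B (t : TreeData n) → blockCount (push v B t) ≡ suc (blockCount t)
blockCount-push v B t = go v (blocks t)
  where
  go : ∀ {m} (v : Fin m) β → Vec.sum (Vec.map length (β [ v ]%= (B ∷_))) ≡ suc (Vec.sum (Vec.map length β))
  go Fin.zero    (bs ∷ β) = refl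
  go (Fin.suc v) (bs ∷ β) = trans (cong (length bs +_) (go v β)) (ℕₚ.+-suc (length bs) _)

count-suc-push : ∀ k v B (ts : List (TreeData n)) → count (suc k) (map (push v B) ts) ≡ count k ts
count-suc-push k v B ts = trans (sumOver-map _ (push v B) ts) (cong sum (map-cong (λ t → cong (δ (suc k)) (blockCount-push v B t)) ts))

count-0-push : ∀ v B (ts : List (TreeData n)) → count 0 (map (push v B) ts) ≡ 0
count-0-push v B ts = trans (sumOver-map _ (push v B) ts) (trans (cong sum (map-cong (λ t → cong (δ 0) (blockCount-push v B t)) ts)) (zeros ts))
  where
  zeros : ∀ {A : Set} (xs : List A) → sumOver (λ _ → 0) xs ≡ 0
  zeros []       = refl
  zeros (_ ∷ xs) = zeros xs

-- Uniqueness is demanded of the block data alone. There `push v B` is injective outright, whereas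
-- on parent maps it forgets the former values on B.
record Forests {n} (st : State n) : Set where
  field
    trees    : List (TreeData n)
    unique   : Unique (map blocks trees)
    sound    : ∀ {t} → t ∈ trees → Valid st t
    complete : ∀ {t} → Valid st t → t ∈ trees
    counts   : ∀ k → count k trees ≡ forests k (#pending st) (#unplaced st)

-- The forests whose first block at v belongs to `Bs`. The list `Bs` is kept general for an
-- induction that ends at `nonemptySubsets st`; the field `first` separates the contributions of
-- different blocks.
record ForestsWithBlock {n} (st : State n) (v : Fin n) (Bs : List (Subset n)) : Set where
  field
    trees    : List (TreeData n)
    unique   : Unique (map blocks trees)
    sound    : ∀ {t} → t ∈ trees → Valid st t
    first    : ∀ {t} → t ∈ trees → ∃ λ B → ∃ λ bs → B ∈ Bs × lookup (blocks t) v ≡ B ∷ bs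
    complete : ∀ {t B bs} → Valid st t → lookup (blocks t) v ≡ B ∷ bs → B ∈ Bs → t ∈ trees
    count-0  : count 0 trees ≡ 0
    counts   : ∀ k → count (suc k) trees ≡ sumOver (afterActivation (forests k) st) Bs

forestsWithBlock : ∀ {st : State n} {v} → lookup st v ≡ pending → ∀ Bs → Unique Bs →
  (∀ {B} → B ∈ Bs → Admissible st B) → (∀ {B} → B ∈ Bs → Forests (activate B st)) → ForestsWithBlock st v Bs
forestsWithBlock v-pending [] _ _ _ = record
  { trees = [] ; unique = [] ; sound = λ () ; first = λ () ; complete = λ _ _ () ; count-0 = refl ; counts = λ _ → refl }
forestsWithBlock {n} {st} {v} v-pending (B ∷ Bs) (B∉Bs ∷ Bs-unique) admissible rec = record
  { trees    = map (push v B) L.trees ++ R.trees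
  ; unique   = subst Unique (sym (map-++ blocks (map (push v B) L.trees) R.trees)) (Uniqueₚ.++⁺ pushed-unique R.unique apart)
  ; sound    = λ t∈ → sound′ (∈-++⁻ (map (push v B) L.trees) t∈)
  ; first    = λ t∈ → first′ (∈-++⁻ (map (push v B) L.trees) t∈)
  ; complete = complete′
  ; count-0  = trans (sumOver-++ _ (map (push v B) L.trees) R.trees) (cong₂ _+_ (count-0-push v B L.trees) R.count-0)
  ; counts   = λ k → trans (sumOver-++ _ (map (push v B) L.trees) R.trees)
      (cong₂ _+_ (trans (count-suc-push k v B L.trees) (L.counts k)) (R.counts k))
  }
  where
  module L = Forests (rec (here refl))
  module R = ForestsWithBlock (forestsWithBlock v-pending Bs Bs-unique (admissible ∘ there) (rec ∘ there))
  updateAt-injective : ∀ {m} (w : Fin m) {β γ : Vec (List (Subset n)) m} → β [ w ]%= (B ∷_) ≡ γ [ w ]%= (B ∷_) → β ≡ γ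
  updateAt-injective Fin.zero    {bs ∷ β} {cs ∷ γ} e with ∷ᵛ-injective e
  ... | refl , refl = refl
  updateAt-injective (Fin.suc w) {bs ∷ β} {cs ∷ γ} e with ∷ᵛ-injective e
  ... | refl , e′ = cong (bs ∷_) (updateAt-injective w e′)
  pushed-unique : Unique (map blocks (map (push v B) L.trees))
  pushed-unique = subst Unique (trans (sym (map-∘ L.trees)) (map-∘ L.trees)) (Uniqueₚ.map⁺ (updateAt-injective v) L.unique)
  first-pushed : ∀ t → lookup (blocks (push v B t)) v ≡ B ∷ lookup (blocks t) v
  first-pushed t = lookup∘updateAt v (blocks t)
  apart : ∀ {β} → ¬ (β ∈ map blocks (map (push v B) L.trees) × β ∈ map blocks R.trees)
  apart (p , q) with ∈-map⁻ blocks p | ∈-map⁻ blocks q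
  ... | t , t∈ , refl | s , s∈ , e with ∈-map⁻ (push v B) t∈
  ...   | t′ , _ , refl with R.first s∈
  ...     | C , cs , C∈Bs , eq = All.lookup B∉Bs C∈Bs
              (∷-injectiveˡ (trans (sym (first-pushed t′)) (trans (cong (λ β → lookup β v) e) eq)))
  sound′ : ∀ {t} → t ∈ map (push v B) L.trees ⊎ t ∈ R.trees → Valid st t
  sound′ (inj₂ t∈) = R.sound t∈
  sound′ (inj₁ t∈) with ∈-map⁻ (push v B) t∈
  ... | _ , t′∈ , refl = push-sound v-pending (admissible (here refl)) (L.sound t′∈)
  first′ : ∀ {t} → t ∈ map (push v B) L.trees ⊎ t ∈ R.trees → ∃ λ C → ∃ λ bs → C ∈ B ∷ Bs × lookup (blocks t) v ≡ C ∷ bs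
  first′ (inj₂ t∈) with R.first t∈
  ... | C , cs , C∈ , eq = C , cs , there C∈ , eq
  first′ (inj₁ t∈) with ∈-map⁻ (push v B) t∈
  ... | t′ , _ , refl = B , _ , here refl , first-pushed t′
  complete′ : ∀ {t C bs} → Valid st t → lookup (blocks t) v ≡ C ∷ bs → C ∈ B ∷ Bs → t ∈ map (push v B) L.trees ++ R.trees
  complete′ V eq (here refl) = ∈-++⁺ˡ (subst (_∈ map (push v B) L.trees) (push-pop v-pending V eq)
    (∈-map⁺ (push v B) (L.complete (pop-complete v-pending V eq))))
  complete′ V eq (there C∈)  = ∈-++⁺ʳ (map (push v B) L.trees) (R.complete V eq C∈)

-- Finishing a pending vertex takes it from 1 to 0, activating an unplaced one from 2 to 1, so both
-- branches of the recurrence decrease.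
measure : State n → ℕ
measure []              = 0
measure (finished ∷ st) = measure st
measure (pending  ∷ st) = 1 + measure st
measure (unplaced ∷ st) = 2 + measure st

measure-finish : ∀ (st : State n) v → lookup st v ≡ pending → suc (measure (finish v st)) ≡ measure st
measure-finish (pending  ∷ st) Fin.zero    _ = refl
measure-finish (finished ∷ st) (Fin.suc v) p = measure-finish st v p
measure-finish (pending  ∷ st) (Fin.suc v) p = cong suc (measure-finish st v p)
measure-finish (unplaced ∷ st) (Fin.suc v) p = cong (2 +_) (measure-finish st v p)

measure-activate-≤ : ∀ B (st : State n) → measure (activate B st) ≤ measure st
measure-activate-≤ []            []              = z≤n
measure-activate-≤ (inside  ∷ B) (finished ∷ st) = measure-activate-≤ B st
measure-activate-≤ (outside ∷ B) (finished ∷ st) = measure-activate-≤ B st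
measure-activate-≤ (inside  ∷ B) (pending  ∷ st) = s≤s (measure-activate-≤ B st)
measure-activate-≤ (outside ∷ B) (pending  ∷ st) = s≤s (measure-activate-≤ B st)
measure-activate-≤ (inside  ∷ B) (unplaced ∷ st) = s≤s (ℕₚ.m≤n⇒m≤1+n (measure-activate-≤ B st))
measure-activate-≤ (outside ∷ B) (unplaced ∷ st) = s≤s (s≤s (measure-activate-≤ B st))

measure-activate-< : ∀ B (st : State n) → Admissible st B → measure (activate B st) < measure st
measure-activate-< (outside ∷ B) (s ∷ st)        A@((Fin.suc u , there _) , _) = later s
  where
  ih = measure-activate-< B st (Admissible-tail A)
  later : ∀ s → measure (activateIf outside s ∷ activate B st) < measure (s ∷ st)
  later finished = ih
  later pending  = s≤s ih
  later unplaced = s≤s (s≤s ih)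
measure-activate-< (inside  ∷ B) (s ∷ st) (_ , U) with U here
... | refl = s≤s (s≤s (measure-activate-≤ B st))

#pending-finish : ∀ (st : State n) v → lookup st v ≡ pending → #pending st ≡ suc (#pending (finish v st))
#pending-finish (pending  ∷ st) Fin.zero    _ = refl
#pending-finish (finished ∷ st) (Fin.suc v) p = #pending-finish st v p
#pending-finish (pending  ∷ st) (Fin.suc v) p = cong suc (#pending-finish st v p)
#pending-finish (unplaced ∷ st) (Fin.suc v) p = #pending-finish st v p

#unplaced-finish : ∀ (st : State n) v → lookup st v ≡ pending → #unplaced st ≡ #unplaced (finish v st)
#unplaced-finish (pending  ∷ st) Fin.zero    _ = refl
#unplaced-finish (finished ∷ st) (Fin.suc v) p = #unplaced-finish st v p
#unplaced-finish (pending  ∷ st) (Fin.suc v) p = #unplaced-finish st v p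
#unplaced-finish (unplaced ∷ st) (Fin.suc v) p = cong suc (#unplaced-finish st v p)

findPending : (st : State n) → (∃ λ v → lookup st v ≡ pending) ⊎ ((∀ v → lookup st v ≢ pending) × #pending st ≡ 0)
findPending [] = inj₂ ((λ ()) , refl)
findPending (pending ∷ st) = inj₁ (Fin.zero , refl)
findPending (finished ∷ st) with findPending st
... | inj₁ (v , p)  = inj₁ (Fin.suc v , p)
... | inj₂ (np , e) = inj₂ ((λ { Fin.zero () ; (Fin.suc v) → np v }) , e)
findPending (unplaced ∷ st) with findPending st
... | inj₁ (v , p)  = inj₁ (Fin.suc v , p)
... | inj₂ (np , e) = inj₂ ((λ { Fin.zero () ; (Fin.suc v) → np v }) , e)

findUnplaced : (st : State n) → (∃ λ v → lookup st v ≡ unplaced × ∃ λ m → #unplaced st ≡ suc m) ⊎ ((∀ v → lookup st v ≢ unplaced) × #unplaced st ≡ 0)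
findUnplaced [] = inj₂ ((λ ()) , refl)
findUnplaced (unplaced ∷ st) = inj₁ (Fin.zero , refl , _ , refl)
findUnplaced (finished ∷ st) with findUnplaced st
... | inj₁ (v , p)  = inj₁ (Fin.suc v , p)
... | inj₂ (np , e) = inj₂ ((λ { Fin.zero () ; (Fin.suc v) → np v }) , e)
findUnplaced (pending ∷ st) with findUnplaced st
... | inj₁ (v , p)  = inj₁ (Fin.suc v , p)
... | inj₂ (np , e) = inj₂ ((λ { Fin.zero () ; (Fin.suc v) → np v }) , e)

unreachable : ∀ {st : State n} {T u} → (∀ v → lookup st v ≢ pending) → ¬ Reach st T u
unreachable np (root p)   = np _ p
unreachable np (step _ r) = unreachable np r

-- An unplaced vertex has no root to ascend to. The formula agrees: S(m+1,0) = 0 for k = 0, and the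
-- factor r is 0 for k > 0.
noForest : ∀ {st : State n} {v m} → (∀ v → lookup st v ≢ pending) → #pending st ≡ 0 →
  lookup st v ≡ unplaced → #unplaced st ≡ suc m → Forests st
noForest {st = st} {m = m} np #p≡0 v-unplaced #u≡suc = record
  { trees = [] ; unique = [] ; sound = λ () ; complete = λ V → ⊥-elim (unreachable np (reach V v-unplaced))
  ; counts = λ k → trans (none k) (sym (cong₂ (forests k) #p≡0 #u≡suc)) }
  where
  none : ∀ k → 0 ≡ forests k 0 (suc m)
  none zero    = refl
  none (suc k) = refl

emptyForest : ∀ n → TreeData n
emptyForest n = treeData (Vec.replicate n nothing) (Vec.replicate n [])

-- All vertices are finished, so none has a parent or a block. The count 1 at k = r = m = 0 is the
-- value that a factor r would destroy, hence the separate clause for `forests zero`.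
onlyEmptyForest : ∀ {st : State n} → (∀ v → lookup st v ≢ pending) → #pending st ≡ 0 →
  (∀ v → lookup st v ≢ unplaced) → #unplaced st ≡ 0 → Forests st
onlyEmptyForest {n} {st} np #p≡0 nu #u≡0 = record
  { trees = emptyForest n ∷ [] ; unique = [] ∷ [] ; sound = λ { (here refl) → valid }
  ; complete = λ V → here (isEmpty V)
  ; counts = λ k → trans (one k) (sym (cong₂ (forests k) #p≡0 #u≡0)) }
  where
  noBlocks : ∀ v → lookup (blocks (emptyForest n)) v ≡ []
  noBlocks v = lookup-replicate v []
  noParent : ∀ v → lookup (parent (emptyForest n)) v ≡ nothing
  noParent v = lookup-replicate v nothing
  valid : Valid st (emptyForest n)
  valid = record
    { nonempty = λ v → subst (All _) (sym (noBlocks v)) []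
    ; disjoint = λ v → subst (AllPairs _) (sym (noBlocks v)) []
    ; covered  = λ {u} {v} a → ⊥-elim (Any-[] (subst (Any _) (noBlocks v) a))
    ; covers   = λ {u} e → ⊥-elim (nothing≢just (noParent u) e)
    ; orphan   = λ {u} _ → noParent u
    ; reach    = λ {u} p → ⊥-elim (nu u p) }
    where
    Any-[] : ∀ {A : Set} {P : A → Set} → ¬ Any P []
    Any-[] ()
  all-finished : ∀ v → lookup st v ≡ finished
  all-finished v with lookup st v | np v | nu v
  ... | finished | _ | _ = refl
  ... | pending  | p | _ = ⊥-elim (p refl)
  ... | unplaced | _ | q = ⊥-elim (q refl)
  isEmpty : ∀ {t} → Valid st t → t ≡ emptyForest n
  isEmpty V = cong₂ treeData
    (lookup-ext λ v → trans (orphan V (nu v)) (sym (noParent v)))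
    (lookup-ext λ v → trans (finished-blockless V (all-finished v)) (sym (noBlocks v)))
  blockCount-empty : ∀ m → Vec.sum (Vec.map length (Vec.replicate m ([] {A = Subset n}))) ≡ 0
  blockCount-empty zero    = refl
  blockCount-empty (suc m) = blockCount-empty m
  one : ∀ k → δ k (blockCount (emptyForest n)) + 0 ≡ forests k 0 0
  one k = trans (cong (λ b → δ k b + 0) (blockCount-empty n)) (δ-0 k)
    where
    δ-0 : ∀ k → δ k 0 + 0 ≡ forests k 0 0
    δ-0 zero    = refl
    δ-0 (suc k) = refl

module _ {st : State n} {v : Fin n} (v-pending : lookup st v ≡ pending)
  (L : Forests (finish v st)) (R : ForestsWithBlock st v (nonemptySubsets st)) where
  private
    module L = Forests L
    module R = ForestsWithBlock R

    blockless : ∀ {t} → t ∈ L.trees → lookup (blocks t) v ≡ []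
    blockless t∈ = finished-blockless (L.sound t∈) (lookup∘updateAt v st)

    apart : ∀ {β} → ¬ (β ∈ map blocks L.trees × β ∈ map blocks R.trees)
    apart (p , q) with ∈-map⁻ blocks p | ∈-map⁻ blocks q
    ... | t , t∈ , refl | s , s∈ , e with R.first s∈
    ...   | _ , _ , _ , eq with trans (sym (blockless t∈)) (trans (cong (λ β → lookup β v) e) eq)
    ...     | ()

    complete′ : ∀ {t} → Valid st t → t ∈ L.trees ++ R.trees
    complete′ {t} V with lookup (blocks t) v in eq
    ... | []     = ∈-++⁺ˡ (L.complete (finish-complete v-pending V eq))
    ... | B ∷ bs = ∈-++⁺ʳ L.trees (R.complete V eq (nonemptySubsets-complete st (first-admissible v-pending V eq)))

    counts′ : ∀ k → count k L.trees + count k R.trees ≡ forests k (#pending st) (#unplaced st)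
    counts′ zero = begin
      count 0 L.trees + count 0 R.trees  ≡⟨ cong₂ _+_ (L.counts 0) R.count-0 ⟩
      S (#unplaced (finish v st)) 0 + 0  ≡⟨ ℕₚ.+-identityʳ _ ⟩
      S (#unplaced (finish v st)) 0      ≡⟨ cong (λ m → S m 0) (#unplaced-finish st v v-pending) ⟨
      S (#unplaced st) 0 ∎
      where open ≡-Reasoning
    counts′ (suc k) = begin
      count (suc k) L.trees + count (suc k) R.trees
        ≡⟨ cong₂ _+_ (L.counts (suc k)) (trans (R.counts k) (sum-nonemptySubsets (forests k) st)) ⟩
      forests (suc k) r (#unplaced (finish v st)) + Σ⁺⊆ (forests k) (#pending st) m
        ≡⟨ cong₂ _+_ (cong (forests (suc k) r) (sym (#unplaced-finish st v v-pending)))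
                     (cong (λ r → Σ⁺⊆ (forests k) r m) (#pending-finish st v v-pending)) ⟩
      forests (suc k) r m + Σ⁺⊆ (forests k) (suc r) m
        ≡⟨ forests-recurrence k r m ⟨
      forests (suc k) (suc r) m
        ≡⟨ cong (λ r → forests (suc k) r m) (#pending-finish st v v-pending) ⟨
      forests (suc k) (#pending st) m ∎
      where
      open ≡-Reasoning
      r = #pending (finish v st)
      m = #unplaced st

  combine : Forests st
  combine = record
    { trees    = L.trees ++ R.trees
    ; unique   = subst Unique (sym (map-++ blocks L.trees R.trees)) (Uniqueₚ.++⁺ L.unique R.unique apart)
    ; sound    = λ t∈ → sound′ (∈-++⁻ L.trees t∈)
    ; complete = complete′
    ; counts   = λ k → trans (sumOver-++ _ L.trees R.trees) (counts′ k)
    }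
    where
    sound′ : ∀ {t} → t ∈ L.trees ⊎ t ∈ R.trees → Valid st t
    sound′ (inj₁ t∈) = finish-sound v-pending (L.sound t∈)
    sound′ (inj₂ t∈) = R.sound t∈

allForests : ∀ N (st : State n) → measure st < N → Forests st
allForests (suc N) st (s≤s m≤N) with findPending st
... | inj₁ (v , v-pending) = combine v-pending
        (allForests N (finish v st) (subst (_≤ N) (sym (measure-finish st v v-pending)) m≤N))
        (forestsWithBlock v-pending (nonemptySubsets st) (nonemptySubsets-unique st) (nonemptySubsets-sound st)
          λ B∈ → allForests N _ (ℕₚ.<-≤-trans (measure-activate-< _ st (nonemptySubsets-sound st B∈)) m≤N))
... | inj₂ (np , #p≡0) with findUnplaced st
...   | inj₁ (v , v-unplaced , m , #u≡suc) = noForest np #p≡0 v-unplaced #u≡suc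
...   | inj₂ (nu , #u≡0) = onlyEmptyForest np #p≡0 nu #u≡0

-- Enriched trees

∈-⋃⁺ : ∀ {u} {bs : List (Subset n)} → Any (u ∈ˢ_) bs → u ∈ˢ ⋃ bs
∈-⋃⁺ (here u∈b) = x∈p∪q⁺ (inj₁ u∈b)
∈-⋃⁺ (there a)  = x∈p∪q⁺ (inj₂ (∈-⋃⁺ a))

∈-⋃⁻ : ∀ {u} (bs : List (Subset n)) → u ∈ˢ ⋃ bs → Any (u ∈ˢ_) bs
∈-⋃⁻ []       u∈ = ⊥-elim (∉⊥ u∈)
∈-⋃⁻ (b ∷ bs) u∈ with x∈p∪q⁻ b (⋃ bs) u∈
... | inj₁ u∈b  = here u∈b
... | inj₂ u∈bs = there (∈-⋃⁻ bs u∈bs)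

∈-children⁺ : ∀ (T : ParentMap n) {u v} → lookup T u ≡ just v → u ∈ˢ children T v
∈-children⁺ T {u} {v} e = lookup⇒[]= u (children T v)
  (trans (lookup∘tabulate _ u) (dec-true (≡-dec _≟ᶠ_ (lookup T u) (just v)) e))

∈-children⁻ : ∀ (T : ParentMap n) {u v} → u ∈ˢ children T v → lookup T u ≡ just v
∈-children⁻ T {u} {v} u∈ with ≡-dec _≟ᶠ_ (lookup T u) (just v)
  | trans (sym (lookup∘tabulate (λ u → does (≡-dec _≟ᶠ_ (lookup T u) (just v))) u)) ([]=⇒lookup u∈)
... | yes e | _ = e
... | no _  | ()

rootedAt : Fin n → State n
rootedAt {n} r = replicate n unplaced [ r ]≔ pending

rootedAt-root : ∀ (r : Fin n) → lookup (rootedAt r) r ≡ pending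
rootedAt-root {n} r = lookup∘updateAt r (replicate n unplaced)

rootedAt-other : ∀ {r u : Fin n} → u ≢ r → lookup (rootedAt r) u ≡ unplaced
rootedAt-other {n} {r} {u} u≢r = trans (lookup∘updateAt′ u r u≢r (replicate n unplaced)) (lookup-replicate u unplaced)

pending⇒root : ∀ {r u : Fin n} → lookup (rootedAt r) u ≡ pending → u ≡ r
pending⇒root {r = r} {u} p with u ≟ᶠ r
... | yes u≡r = u≡r
... | no u≢r  = ⊥-elim (pending≢unplaced p (rootedAt-other u≢r))

enriched-sound : ∀ {r : Fin n} {t} → Valid (rootedAt r) t → IsEnrichedTree t
enriched-sound {r = r} {t} V = (r , orphan V (pending≢unplaced (rootedAt-root r)) , path) , partition
  where
  toStar : ∀ {u} → Reach (rootedAt r) (parent t) u → Star (HasParent (parent t)) u r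
  toStar (root p)   = subst (λ w → Star (HasParent (parent t)) w r) (sym (pending⇒root p)) ε
  toStar (step e s) = e ◅ toStar s
  path : ∀ v → Star (HasParent (parent t)) v r
  path v with v ≟ᶠ r
  ... | yes refl = ε
  ... | no v≢r   = toStar (reach V (rootedAt-other v≢r))
  partition : ∀ v → IsOrderedPartition (lookup (blocks t) v) (children (parent t) v)
  partition v = nonempty V v , disjoint V v , ⊆-antisym
    (λ u∈ → ∈-children⁺ (parent t) (covered V (∈-⋃⁻ (lookup (blocks t) v) u∈)))
    (λ u∈ → ∈-⋃⁺ (covers V (∈-children⁻ (parent t) u∈)))

enriched-complete : ∀ {t : TreeData n} → ((((r , _)) , _) : IsEnrichedTree t) → Valid (rootedAt r) t
enriched-complete {t = t} ((r , r-orphan , path) , partition) = record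
  { nonempty = λ v → proj₁ (partition v)
  ; disjoint = λ v → proj₁ (proj₂ (partition v))
  ; covered  = λ {u} {v} a → ∈-children⁻ (parent t) (subst (u ∈ˢ_) (proj₂ (proj₂ (partition v))) (∈-⋃⁺ a))
  ; covers   = λ {u} {v} e → ∈-⋃⁻ (lookup (blocks t) v) (subst (u ∈ˢ_) (sym (proj₂ (proj₂ (partition v)))) (∈-children⁺ (parent t) e))
  ; orphan   = orphan′
  ; reach    = λ {u} _ → fromStar (path u)
  }
  where
  orphan′ : ∀ {u} → lookup (rootedAt r) u ≢ unplaced → lookup (parent t) u ≡ nothing
  orphan′ {u} ¬p with u ≟ᶠ r
  ... | yes refl = r-orphan
  ... | no u≢r   = ⊥-elim (¬p (rootedAt-other u≢r))
  fromStar : ∀ {u} → Star (HasParent (parent t)) u r → Reach (rootedAt r) (parent t) u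
  fromStar ε       = root (rootedAt-root r)
  fromStar (e ◅ s) = step e (fromStar s)

#pending-rootedAt : ∀ (r : Fin n) → #pending (rootedAt r) ≡ 1
#pending-rootedAt {suc n} Fin.zero    = cong suc (go n)
  where
  go : ∀ n → #pending (replicate n unplaced) ≡ 0
  go zero    = refl
  go (suc n) = go n
#pending-rootedAt {suc n} (Fin.suc r) = #pending-rootedAt r

#unplaced-rootedAt : ∀ (r : Fin n) → suc (#unplaced (rootedAt r)) ≡ n
#unplaced-rootedAt {suc n} Fin.zero    = cong suc (go n)
  where
  go : ∀ n → #unplaced (replicate n unplaced) ≡ n
  go zero    = refl
  go (suc n) = cong suc (go n)
#unplaced-rootedAt {suc n} (Fin.suc r) = cong suc (#unplaced-rootedAt r)

treesRootedAt : (r : Fin n) → Forests (rootedAt r)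
treesRootedAt r = allForests _ (rootedAt r) (ℕₚ.n<1+n (measure (rootedAt r)))

treeList : Fin n → List (TreeData n)
treeList r = Forests.trees (treesRootedAt r)

allTrees : ∀ n → List (TreeData n)
allTrees n = concat (List.tabulate treeList)

enumeration : ∀ n → Enumeration n
enumeration n = record
  { list     = allTrees n
  ; unique   = Uniqueₚ.concat⁺ (Allₚ.tabulate⁺ (λ r → Uniqueₚ.map⁻ (Forests.unique (treesRootedAt r))))
                 (AllPairsₚ.tabulate⁺ apart)
  ; sound    = sound′
  ; complete = λ t-tree@((r , _) , _) → ∈-concat⁺′ (Forests.complete (treesRootedAt r) (enriched-complete t-tree))
                 (∈-tabulate⁺ {f = treeList} r)
  }
  where
  -- In a tree listed under s, the vertex r ascends to a root other than itself and so has a parent;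
  -- in a tree listed under r it has none.
  apart : ∀ {r s : Fin n} → r ≢ s → ∀ {t} → ¬ (t ∈ treeList r × t ∈ treeList s)
  apart {r} {s} r≢s (p , q) with reach (Forests.sound (treesRootedAt s) q) (rootedAt-other r≢s)
  ... | root e   = r≢s (pending⇒root e)
  ... | step e _ = nothing≢just (orphan (Forests.sound (treesRootedAt r) p) (pending≢unplaced (rootedAt-root r))) e
  sound′ : ∀ {t} → t ∈ allTrees n → IsEnrichedTree t
  sound′ t∈ with ∈-concat⁻′ (List.tabulate treeList) t∈
  ... | ts , t∈ts , ts∈ with ∈-tabulate⁻ {f = treeList} ts∈
  ...   | r , refl = enriched-sound (Forests.sound (treesRootedAt r) t∈ts)

count-concat-tabulate : ∀ {m} k c (f : Fin m → List (TreeData n)) → (∀ i → count k (f i) ≡ c) → count k (concat (List.tabulate f)) ≡ m * c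
count-concat-tabulate {m = zero}  k c f e = refl
count-concat-tabulate {m = suc m} k c f e = trans (sumOver-++ _ (f Fin.zero) (concat (List.tabulate (f ∘ Fin.suc))))
  (cong₂ _+_ (e Fin.zero) (count-concat-tabulate k c (f ∘ Fin.suc) (e ∘ Fin.suc)))

-- For k > 0 the n = j + 1 choices of the root supply the factor n with which the product
-- (n+1)...(n+k-1) in `forests k 1 j` becomes the full rising factorial.
count-allTrees : ∀ j k → count k (allTrees (suc j)) ≡ S j k * rising (suc j) k
count-allTrees j k = trans
  (count-concat-tabulate k (forests k 1 j) treeList (λ r → trans (Forests.counts (treesRootedAt r) k)
    (cong₂ (forests k) (#pending-rootedAt r) (ℕₚ.suc-injective (#unplaced-rootedAt r)))))
  (closed j k)
  where
  open ≡-Reasoning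
  closed : ∀ j k → suc j * forests k 1 j ≡ S j k * rising (suc j) k
  closed zero    zero    = refl
  closed (suc j) zero    = ℕₚ.*-zeroʳ (suc j)
  closed j       (suc k) = begin
    suc j * (1 * (S j (suc k) * rising (suc (j + 1)) k))  ≡⟨ cong (suc j *_) (ℕₚ.*-identityˡ _) ⟩
    suc j * (S j (suc k) * rising (suc (j + 1)) k)        ≡⟨ cong (λ m → suc j * (S j (suc k) * rising (suc m) k)) (ℕₚ.+-comm j 1) ⟩
    suc j * (S j (suc k) * rising (suc (suc j)) k)        ≡⟨ x∙yz≈y∙xz (suc j) (S j (suc k)) _ ⟩
    S j (suc k) * (suc j * rising (suc (suc j)) k)        ≡⟨ cong (S j (suc k) *_) (rising-suc (suc j) k) ⟨
    S j (suc k) * rising (suc j) (suc k) ∎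
    where open CommutativeSemigroupProperties ℕₚ.*-commutativeSemigroup using (x∙yz≈y∙xz)

-- Comparison of counts and coefficients

-- Duplicate-free lists with the same members are permutations of each other, so any enumeration can
-- be exchanged for the constructed one.
count-enumeration : ∀ (E F : Enumeration n) k → count k (list E) ≡ count k (list F)
count-enumeration E F k = sum-↭ (↭ₚ.map⁺ _ (∼bag⇒↭ (unique∧set⇒bag (unique E) (unique F)
  (mk⇔ (λ t∈ → complete F (sound E t∈)) (λ t∈ → complete E (sound F t∈))))))

ι-+ : ∀ m k → ι (m + k) ≡ ι m ℚ.+ ι k
ι-+ zero    k = sym (ℚₚ.+-identityˡ (ι k))
ι-+ (suc m) k = trans (cong (1ℚ ℚ.+_) (ι-+ m k)) (sym (ℚₚ.+-assoc 1ℚ (ι m) (ι k)))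

ι-* : ∀ m k → ι (m * k) ≡ ι m ℚ.* ι k
ι-* zero    k = sym (ℚₚ.*-zeroˡ (ι k))
ι-* (suc m) k = trans (ι-+ k (m * k)) (trans (cong₂ ℚ._+_ (sym (ℚₚ.*-identityˡ (ι k))) (ι-* m k)) (sym (ℚₚ.*-distribʳ-+ (ι k) 1ℚ (ι m))))

-- The factor n + k in `next` completes `rising n k` to `rising n (suc k)`; once this common factor
-- is taken out, the Stirling recurrence remains.
coefficients-closed : ∀ n j k → coefficients n j k ≡ ι (S j k * rising n k)
coefficients-closed n zero    zero    = refl
coefficients-closed n zero    (suc k) = refl
coefficients-closed n (suc j) zero    = refl
coefficients-closed n (suc j) (suc k) = begin
  ι (suc k) ℚ.* coefficients n j (suc k) ℚ.+ ι (n + k) ℚ.* coefficients n j k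
    ≡⟨ cong₂ (λ x y → ι (suc k) ℚ.* x ℚ.+ ι (n + k) ℚ.* y) (coefficients-closed n j (suc k)) (coefficients-closed n j k) ⟩
  ι (suc k) ℚ.* ι (s₁ * (ρ * (n + k))) ℚ.+ ι (n + k) ℚ.* ι (s₀ * ρ)
    ≡⟨ cong₂ ℚ._+_ (ι-* (suc k) (s₁ * (ρ * (n + k)))) (ι-* (n + k) (s₀ * ρ)) ⟨
  ι (suc k * (s₁ * (ρ * (n + k)))) ℚ.+ ι ((n + k) * (s₀ * ρ))
    ≡⟨ ι-+ (suc k * (s₁ * (ρ * (n + k)))) ((n + k) * (s₀ * ρ)) ⟨
  ι (suc k * (s₁ * (ρ * (n + k))) + (n + k) * (s₀ * ρ))
    ≡⟨ cong ι (solve 5 (λ k a r x b → (con 1 :+ k) :* (a :* (r :* x)) :+ x :* (b :* r) := ((con 1 :+ k) :* a :+ b) :* (r :* x)) refl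
         k s₁ ρ (n + k) s₀) ⟩
  ι (S (suc j) (suc k) * rising n (suc k)) ∎
  where
  open ≡-Reasoning
  open +-*-Solver
  s₁ = S j (suc k)
  s₀ = S j k
  ρ = rising n k

X*ᴾ≋0∷ : ∀ p → X *ᴾ p ≋ 0ℚ ∷ p
X*ᴾ≋0∷ p = ≋-trans (0∷-*ᴾ 1ᴾ p) (∷-cong refl (*ᴾ-identityˡ p))

coeff-X^ : ∀ j k → coeff (X ^ᴾ j) k ≡ ι (δ k j)
coeff-X^ zero    zero    = refl
coeff-X^ zero    (suc k) = refl
coeff-X^ (suc j) zero    = at (X*ᴾ≋0∷ (X ^ᴾ j)) 0
coeff-X^ (suc j) (suc k) = trans (at (X*ᴾ≋0∷ (X ^ᴾ j)) (suc k)) (coeff-X^ j k)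

coeff-weights : ∀ (ts : List (TreeData n)) k → coeff (List.foldr (λ t p → weight t +ᴾ p) 0ᴾ ts) k ≡ ι (count k ts)
coeff-weights []       k = refl
coeff-weights (t ∷ ts) k = trans (coeff-+ (weight t) _ k)
  (trans (cong₂ ℚ._+_ (coeff-X^ (blockCount t) k) (coeff-weights ts k)) (sym (ι-+ (δ k (blockCount t)) (count k ts))))

coeff-numeratorSum : ∀ {m} (a : Fin m → ℚ) k → coeff (numeratorSum a) k ≡ extend a k
coeff-numeratorSum {zero}  a k = refl
coeff-numeratorSum {suc m} a k = trans (at unfold k) (cases k)
  where
  a₀ = const (a Fin.zero)
  open PolySolver
  shift : ∀ a x z → a *ᴾ (x *ᴾ z) ≋ x *ᴾ (a *ᴾ z)
  shift = solve 3 (λ a x z → a :* (x :* z) := x :* (a :* z)) ≋-refl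
  unfold : numeratorSum a ≋ a₀ +ᴾ (0ℚ ∷ numeratorSum (a ∘ Fin.suc))
  unfold = +ᴾ-cong (≋-trans (*ᴾ-comm a₀ 1ᴾ) (*ᴾ-identityˡ a₀))
    (≋-trans (sumᴾ-cong (λ i → shift (const (a (Fin.suc i))) X (X ^ᴾ toℕ i)))
    (≋-trans (*ᴾ-distribˡ-sumᴾ X (λ i → monomial (a (Fin.suc i)) (toℕ i))) (X*ᴾ≋0∷ (numeratorSum (a ∘ Fin.suc)))))
  cases : ∀ k → coeff (a₀ +ᴾ (0ℚ ∷ numeratorSum (a ∘ Fin.suc))) k ≡ extend a k
  cases zero    = ℚₚ.+-identityʳ (a Fin.zero)
  cases (suc k) = coeff-numeratorSum (a ∘ Fin.suc) k

proposition7 : (n : ℕ) → 1 ≤ n →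
    Enumeration n
    × ∃! _≗_ (IsSimpleFractionExpansion n)
    × ((E : Enumeration n) (a : Fin n → ℚ) → IsSimpleFractionExpansion n a →
    generatingPolynomial E ≈ᴾ numeratorSum a)
proposition7 (suc j) _ =
  enumeration (suc j) ,
  ((λ k → coefficients (suc j) j (toℕ k)) , expansion-exists j , λ {a} e → expansion-unique j a e) ,
  λ E a e k → begin
    coeff (generatingPolynomial E) k              ≡⟨ coeff-weights (list E) k ⟩
    ι (count k (list E))                          ≡⟨ cong ι (count-enumeration E (enumeration (suc j)) k) ⟩
    ι (count k (allTrees (suc j)))                ≡⟨ cong ι (count-allTrees j k) ⟩
    ι (S j k * rising (suc j) k)                  ≡⟨ coefficients-closed (suc j) j k ⟨
    -- The given `a` is arbitrary: uniqueness identifies it with the computed coefficients up to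
    -- index j, and beyond j both sides are zero.
    coefficients (suc j) j k                      ≡⟨ extend-≡ (expansion-unique j a e) (coefficients-degree (suc j) j) k ⟨
    extend a k                                    ≡⟨ coeff-numeratorSum a k ⟨
    coeff (numeratorSum a) k ∎
  where open ≡-Reasoning
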